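{- 1. If $p\ge 5$ is a prime, then $v_{(p+3)/2}\equiv -2p^3\pmod{p^4}$ and $v_{(p+3)/2}\equiv 2p^3(1-p)\,(p-1)!\,4^{p-1}\pmod{p^5}$. 2. Let $r\ge 1$ be an integer and $p\ge 2r+1$ a prime. Then $v_{\frac{p+3}{2}+rp}\equiv C_r\,p^{2r+2}\pmod{p^{2r+3}}$, where $$C_r=\frac{r}{(-4)^{r-1}}\Big(\frac{2r+1}{r!}\Big)^2\sum_{j=0}^{2r}b_{j,r}\,((1-2j))_{2r-1}.$$
   Context: For an integer $n\ge 1$ let $v_n=\Big[(1-x)\prod_{j=0}^{2n-3}(2n-3-j+jx)\Big]_{x^{n-1}}$, where $[f(x)]_{x^m}$ denotes the coefficient of $x^m$ in $f$. The integers $b_{j,r}$ are defined by $\prod_{a=1}^{2r}(2r+1-a+ax)=\sum_{j=0}^{2r}b_{j,r}x^j$, and for a number $u$ and integer $a\ge 1$, $((u))_a:=\prod_{j=1}^{a}(u+2j-2)$. The congruence in part 2 is understood in the sense that $C_r p^{2r+2}$ is a rational number whose denominator is prime to $p$. -}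

module Defs where

open import Data.Nat as ℕ using (ℕ; zero; suc; _∸_; NonZero)
open import Data.Nat.Properties using (m^n≢0; m*n≢0; _!≢0)
open import Data.Nat.Coprimality using (Coprime)
open import Data.Integer as ℤ using (ℤ; +_; -_; _-_)
open import Data.Integer.Divisibility using (_∣_)
open import Data.Rational as ℚ using (ℚ; ↥_; ↧_; ↧ₙ_)
open import Data.Product using (_×_)
open import Data.List using (List; []; _∷_; map; foldr; upTo)

-- Univariate polynomials over ℤ as coefficient lists (lowest degree first)

Poly : Set
Poly = List ℤ

infixl 6 _⊕_
infixl 7 _⊛_

_⊕_ : Poly → Poly → Poly
[]       ⊕ q        = q
(a ∷ p)  ⊕ []       = a ∷ p
(a ∷ p)  ⊕ (b ∷ q)  = (a ℤ.+ b) ∷ (p ⊕ q)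

scale : ℤ → Poly → Poly
scale c = map (c ℤ.*_)

_⊛_ : Poly → Poly → Poly
[]      ⊛ q = []
(a ∷ p) ⊛ q = scale a q ⊕ (+ 0 ∷ (p ⊛ q))

one : Poly
one = + 1 ∷ []

prodP : List Poly → Poly
prodP = foldr _⊛_ one

coeff : ℕ → Poly → ℤ
coeff m       []      = + 0
coeff zero    (a ∷ p) = a
coeff (suc m) (a ∷ p) = coeff m p

lin : ℤ → ℤ → Poly
lin a b = a ∷ b ∷ []

-- v_n = [ (1 - x) ∏_{j=0}^{2n-3} (2n-3-j + j x) ]_{x^{n-1}}
-- (for n = 1 the product is empty; with m = 2n-2 factors, the j-th
--  factor is (m-1-j) + j x, j = 0 .. m-1)

vPoly : ℕ → Poly
vPoly n = lin (+ 1) (- (+ 1)) ⊛ prodP (map (λ j → lin (+ (m ∸ 1 ∸ j)) (+ j)) (upTo m))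
  where m = 2 ℕ.* n ∸ 2

v : ℕ → ℤ
v n = coeff (n ∸ 1) (vPoly n)

-- b_{j,r}: ∏_{a=1}^{2r} (2r+1-a + a x) = Σ_j b_{j,r} x^j

bPoly : ℕ → Poly
bPoly r = prodP (map (λ i → lin (+ (2 ℕ.* r ∸ i)) (+ (suc i))) (upTo (2 ℕ.* r)))
  -- i = a - 1 ranges over 0 .. 2r-1, so a = i+1 and 2r+1-a = 2r-i

b : ℕ → ℕ → ℤ
b j r = coeff j (bPoly r)

-- ((u))_a = ∏_{j=1}^{a} (u + 2j - 2)
dfact : ℤ → ℕ → ℤ
dfact u a = foldr (λ i acc → (u ℤ.+ + (2 ℕ.* i)) ℤ.* acc) (+ 1) (upTo a)
  -- i = j - 1 ranges over 0 .. a-1, and u + 2j - 2 = u + 2i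

sumℤ : List ℤ → ℤ
sumℤ = foldr ℤ._+_ (+ 0)

Ssum : ℕ → ℤ
Ssum r = sumℤ (map (λ j → b j r ℤ.* dfact (+ 1 - + (2 ℕ.* j)) (2 ℕ.* r ∸ 1))
                   (upTo (suc (2 ℕ.* r))))

-- C_r = r / (-4)^{r-1} * ((2r+1)/r!)^2 * S_r
--     = (-1)^{r-1} r (2r+1)^2 S_r / (4^{r-1} (r!)^2)   (for r ≥ 1)

Cden : ℕ → ℕ
Cden r = 4 ℕ.^ (r ∸ 1) ℕ.* (r ℕ.! ℕ.* r ℕ.!)

Cden≢0 : ∀ r → NonZero (Cden r)
Cden≢0 r = m*n≢0 (4 ℕ.^ (r ∸ 1)) (r ℕ.! ℕ.* r ℕ.!)
  {{m^n≢0 4 (r ∸ 1)}} {{m*n≢0 (r ℕ.!) (r ℕ.!) {{r !≢0}} {{r !≢0}}}}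

C : ℕ → ℚ
C r = (((- (+ 1)) ℤ.^ (r ∸ 1) ℤ.* + r ℤ.* (+ (suc (2 ℕ.* r))) ℤ.^ 2 ℤ.* Ssum r)
      ℚ./ Cden r) {{Cden≢0 r}}

_≡_modℚ_ : ℤ → ℚ → ℕ → Set
x ≡ q modℚ m = Coprime (↧ₙ q) m × ((+ m) ∣ (x ℤ.* ↧ q - ↥ q))

{-# OPTIONS --safe #-}
module Submission where

-- Write p = 2h + 1, w = 1 - x and c(n, k) = [x^k] w^n. For n = (p + 3)/2 + r p the product has degree
-- D + 1 with D = (2r + 1) p; its factors with index a multiple of p contribute
-- p^(2r+2) (2r + 1)² x ∏_{a=1}^{2r} (2r + 1 - a + a x), and every other factor is congruent to an
-- integer multiple of w modulo p. By Wilson's theorem the latter multiply to -w^((2r+1)(p-1)), so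
-- part 2 becomes a congruence for c(D - 2r, rp + h - j), which follows from c(D - 1, ·) (constant
-- modulo p on blocks of length p) and from n c(n - 1, k) = (n - k) c(n, k).
-- In part 1 (r = 0) pairing the factors k and p - k gives k (p - k) w² + p² x, and since
-- ∑ 1/k² ≡ 0 mod p the remaining product is (p - 1)! w^(p-1) modulo p³. This leaves c(p, h), which
-- is given by Morley's congruence.
-- Wilson's and Fermat's theorems come from one source: w^(p-1) ≡ ∑_{k<p} x^k mod p, that is, the
-- (p-1)-st finite difference of a sequence is congruent to the sum of p consecutive terms.

open import Defs
open import Level using (0ℓ)
open import Data.Nat as ℕ using (ℕ; zero; suc; z≤n; s≤s; NonZero; _!)
import Data.Nat.Properties as ℕP
import Data.Nat.DivMod as ℕDivMod
import Data.Nat.Divisibility as ℕD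
import Data.Nat.Tactic.RingSolver as ℕSolver
open import Data.Nat.Coprimality as Coprimality using (Coprime)
open import Data.Nat.Primality as Primality using (Prime)
open import Data.Integer as ℤ using (ℤ; +_; -_; _-_; ∣_∣)
import Data.Integer.Properties as ℤP
open import Data.Integer.Divisibility using (_∣_)
open import Data.Integer.Divisibility.Signed as Signed using (divides)
open import Data.Integer.Tactic.RingSolver using (solve-∀)
open import Data.Rational as ℚ using (ℚ; ↥_; ↧_; ↧ₙ_)
import Data.Rational.Properties as ℚP
import Data.Rational.Unnormalised as ℚᵘ
import Data.Rational.Unnormalised.Properties as ℚᵘP
open import Data.List using ([]; _∷_; map; foldr; upTo; applyUpTo)
open import Data.List.Properties using (map-upTo)
open import Data.Product using (_,_; _×_; ∃)
open import Data.Sum using (_⊎_; inj₁; inj₂)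
open import Algebra using (CommutativeMonoid; CommutativeRing)
import Algebra.Construct.Pointwise as Pointwise
import Algebra.Solver.Ring.NaturalCoefficients.Default as Solver
import Relation.Binary.Reasoning.Setoid as SetoidReasoning
open import Relation.Binary.PropositionalEquality as ≡ using (_≡_; cong; cong₂; subst)
open import Relation.Nullary using (yes; no)
open import Function using (_∘_; id; const)

-- Folds, convolutions and linear series take only raw operations as parameters, so that over
-- different moduli they are definitionally the same integers.

-- No inverses modulo a power of p are formed: a quotient is stated multiplied by its denominator,
-- and `mod-cancel` removes the factors prime to p. In particular ∑ 1/k² becomes `omitted`, the same
-- sum times the full product. In part 2 the row D - 1 is the right target for two reasons. The
-- factors D - 2r + 1, ..., D - 1 met on the way up are -(2r - 1), ..., -1 modulo p, hence
-- invertible because 2r < p, whereas the next one would be D, a multiple of p. And D - 1 ≡ -1 mod p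
-- is what makes neighbouring entries inside a block congruent. The column in question satisfies 2
-- (rp + h) ≡ -1 mod p, so it is a half-integer modulo p; this is where the double factorials with
-- start 1 - 2j come from. In part 1 the factor p² leaves v and one more p leaves c(p, h), so c(p -
-- 1, h) is needed modulo p² only.

big : ∀ {c} {A : Set c} → (A → A → A) → A → ℕ → (ℕ → A) → A
big _∙_ ε zero    f = ε
big _∙_ ε (suc n) f = f 0 ∙ big _∙_ ε n (f ∘ suc)

convolve : ∀ {c} {A : Set c} → (A → A → A) → (A → A → A) → (ℕ → A) → (ℕ → A) → ℕ → A
convolve _+_ _*_ f g zero    = f 0 * g 0
convolve _+_ _*_ f g (suc k) = (f 0 * g (suc k)) + convolve _+_ _*_ (f ∘ suc) g k

constant : ∀ {c} {A : Set c} → A → A → ℕ → A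
constant z a zero    = a
constant z a (suc _) = z

linear : ∀ {c} {A : Set c} → A → A → A → ℕ → A
linear z a b zero    = a
linear z a b (suc k) = constant z b k

-- The coefficient of u in ∏ (f i + u).
omit : ∀ {c} {A : Set c} → (A → A → A) → (A → A → A) → A → A → ℕ → (ℕ → A) → A
omit _+_ _*_ z o zero    f = z
omit _+_ _*_ z o (suc n) f = (f 0 * omit _+_ _*_ z o n (f ∘ suc)) + big _*_ o n (f ∘ suc)

-- Folds over a commutative monoid and their reindexing

module Big {c ℓ} (M : CommutativeMonoid c ℓ) where
  open CommutativeMonoid M
  open SetoidReasoning setoid

  fold : ℕ → (ℕ → Carrier) → Carrier
  fold = big _∙_ ε

  cong-< : ∀ n {f g} → (∀ i → i ℕ.< n → f i ≈ g i) → fold n f ≈ fold n g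
  cong-< zero    e = refl
  cong-< (suc n) e = ∙-cong (e 0 (ℕ.s≤s ℕ.z≤n)) (cong-< n λ i i<n → e (suc i) (ℕ.s≤s i<n))

  cong-≈ : ∀ n {f g} → (∀ i → f i ≈ g i) → fold n f ≈ fold n g
  cong-≈ n e = cong-< n λ i _ → e i

  fold-ε : ∀ n → fold n (const ε) ≈ ε
  fold-ε zero    = refl
  fold-ε (suc n) = trans (identityˡ _) (fold-ε n)

  interchange : ∀ a b x y → (a ∙ b) ∙ (x ∙ y) ≈ (a ∙ x) ∙ (b ∙ y)
  interchange a b x y = begin
    (a ∙ b) ∙ (x ∙ y) ≈⟨ assoc a b _ ⟩
    a ∙ (b ∙ (x ∙ y)) ≈⟨ ∙-congˡ (sym (assoc b x y)) ⟩
    a ∙ ((b ∙ x) ∙ y) ≈⟨ ∙-congˡ (∙-congʳ (comm b x)) ⟩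
    a ∙ ((x ∙ b) ∙ y) ≈⟨ ∙-congˡ (assoc x b y) ⟩
    a ∙ (x ∙ (b ∙ y)) ≈⟨ sym (assoc a x _) ⟩
    (a ∙ x) ∙ (b ∙ y) ∎

  leftCommute : ∀ a b x → a ∙ (b ∙ x) ≈ b ∙ (a ∙ x)
  leftCommute a b x = trans (sym (assoc a b x)) (trans (∙-congʳ (comm a b)) (assoc b a x))

  zip : ∀ n f g → fold n (λ i → f i ∙ g i) ≈ fold n f ∙ fold n g
  zip zero    f g = sym (identityˡ ε)
  zip (suc n) f g = trans (∙-congˡ (zip n (f ∘ suc) (g ∘ suc))) (interchange _ _ _ _)

  snoc : ∀ n f → fold (suc n) f ≈ fold n f ∙ f n
  snoc zero    f = comm (f 0) ε
  snoc (suc n) f = trans (∙-congˡ (snoc n (f ∘ suc))) (sym (assoc _ _ _))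

  concat : ∀ m n f → fold (m ℕ.+ n) f ≈ fold m f ∙ fold n (λ i → f (m ℕ.+ i))
  concat zero    n f = sym (identityˡ _)
  concat (suc m) n f = trans (∙-congˡ (concat m n (f ∘ suc))) (sym (assoc _ _ _))

  blocks : ∀ n q f → fold (n ℕ.* q) f ≈ fold n (λ i → fold q (λ k → f (i ℕ.* q ℕ.+ k)))
  blocks zero    q f = refl
  blocks (suc n) q f = begin
    fold (q ℕ.+ n ℕ.* q) f
      ≈⟨ concat q (n ℕ.* q) f ⟩
    fold q f ∙ fold (n ℕ.* q) (λ i → f (q ℕ.+ i))
      ≈⟨ ∙-congˡ (blocks n q _) ⟩
    fold q f ∙ fold n (λ i → fold q (λ k → f (q ℕ.+ (i ℕ.* q ℕ.+ k))))
      ≈⟨ ∙-congˡ (cong-≈ n λ i → cong-≈ q λ k → reflexive (cong f (≡.sym (ℕP.+-assoc q (i ℕ.* q) k)))) ⟩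
    fold q f ∙ fold n (λ i → fold q (λ k → f (q ℕ.+ i ℕ.* q ℕ.+ k))) ∎

  reverse : ∀ n f → fold n f ≈ fold n (λ i → f (n ℕ.∸ suc i))
  reverse zero    f = refl
  reverse (suc n) f = trans (snoc n f) (trans (∙-congʳ (reverse n f)) (comm _ _))

  pairing : ∀ h f → fold (h ℕ.+ h) f ≈ fold h (λ k → f k ∙ f (h ℕ.+ h ℕ.∸ suc k))
  pairing h f = begin
    fold (h ℕ.+ h) f
      ≈⟨ concat h h f ⟩
    fold h f ∙ fold h (λ i → f (h ℕ.+ i))
      ≈⟨ ∙-congˡ (reverse h _) ⟩
    fold h f ∙ fold h (λ i → f (h ℕ.+ (h ℕ.∸ suc i)))
      ≈⟨ ∙-congˡ (cong-< h λ i i<h → reflexive (cong f (≡.sym (ℕP.+-∸-assoc h i<h)))) ⟩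
    fold h f ∙ fold h (λ i → f (h ℕ.+ h ℕ.∸ suc i))
      ≈⟨ sym (zip h _ _) ⟩
    fold h (λ k → f k ∙ f (h ℕ.+ h ℕ.∸ suc k)) ∎

  even-odd : ∀ h f → fold (h ℕ.+ h) f ≈ fold h (λ i → f (i ℕ.+ i)) ∙ fold h (λ i → f (suc (i ℕ.+ i)))
  even-odd h f = begin
    fold (h ℕ.+ h) f                             ≡⟨ cong (λ n → fold n f) (double h) ⟩
    fold (h ℕ.* 2) f                             ≈⟨ blocks h 2 f ⟩
    fold h (λ i → fold 2 (λ k → f (i ℕ.* 2 ℕ.+ k))) ≈⟨ cong-≈ h step ⟩
    fold h (λ i → f (i ℕ.+ i) ∙ f (suc (i ℕ.+ i))) ≈⟨ zip h _ _ ⟩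
    fold h (λ i → f (i ℕ.+ i)) ∙ fold h (λ i → f (suc (i ℕ.+ i))) ∎
    where
    double : ∀ n → n ℕ.+ n ≡ n ℕ.* 2
    double n = ≡.trans (cong (n ℕ.+_) (≡.sym (ℕP.+-identityʳ n))) (ℕP.*-comm 2 n)
    step : ∀ i → fold 2 (λ k → f (i ℕ.* 2 ℕ.+ k)) ≈ f (i ℕ.+ i) ∙ f (suc (i ℕ.+ i))
    step i = ∙-cong
      (reflexive (cong f (≡.trans (ℕP.+-identityʳ _) (≡.sym (double i)))))
      (trans (identityʳ _)
        (reflexive (cong f (≡.trans (ℕP.+-comm (i ℕ.* 2) 1) (cong suc (≡.sym (double i)))))))

  -- Doubling permutes the nonzero residues modulo 2 h + 1.
  doubling : ∀ h f → (∀ i → f (suc (h ℕ.+ h) ℕ.+ i) ≈ f i) →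
    fold (h ℕ.+ h) (λ k → f (suc k ℕ.+ suc k)) ≈ fold (h ℕ.+ h) (f ∘ suc)
  doubling h f periodic = begin
    fold (h ℕ.+ h) (λ k → f (suc k ℕ.+ suc k))
      ≈⟨ concat h h _ ⟩
    fold h (λ k → f (suc k ℕ.+ suc k)) ∙ fold h (λ k → f (suc (h ℕ.+ k) ℕ.+ suc (h ℕ.+ k)))
      ≈⟨ ∙-cong (cong-≈ h λ k → reflexive (cong f (cong suc (ℕP.+-suc k k))))
                (cong-≈ h λ k → trans (reflexive (cong f (shuffle k))) (periodic _)) ⟩
    fold h (λ k → f (suc (suc (k ℕ.+ k)))) ∙ fold h (λ k → f (suc (k ℕ.+ k)))
      ≈⟨ comm _ _ ⟩
    fold h (λ k → f (suc (k ℕ.+ k))) ∙ fold h (λ k → f (suc (suc (k ℕ.+ k))))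
      ≈⟨ sym (even-odd h (f ∘ suc)) ⟩
    fold (h ℕ.+ h) (f ∘ suc) ∎
    where
    shuffle′ : ∀ h k → suc (h ℕ.+ k) ℕ.+ suc (h ℕ.+ k) ≡ suc (h ℕ.+ h) ℕ.+ suc (k ℕ.+ k)
    shuffle′ = ℕSolver.solve-∀
    shuffle : ∀ k → suc (h ℕ.+ k) ℕ.+ suc (h ℕ.+ k) ≡ suc (h ℕ.+ h) ℕ.+ suc (k ℕ.+ k)
    shuffle k = shuffle′ h k

-- Products, sums and first-order expansions in a commutative ring

module Ring (R : CommutativeRing 0ℓ 0ℓ) where
  open CommutativeRing R public
  open SetoidReasoning setoid public
  open Solver commutativeSemiring using (_:+_; _:*_; con; _:=_) renaming (solve to ring-solve)
  module Π = Big *-commutativeMonoid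
  module Σ = Big +-commutativeMonoid
  open Π public renaming (fold to prod) using ()
  open Σ public renaming (fold to sum) using ()

  pow : ℕ → Carrier → Carrier
  pow n x = prod n (const x)

  pow-cong : ∀ n {x y} → x ≈ y → pow n x ≈ pow n y
  pow-cong n e = Π.cong-≈ n λ _ → e

  *-sum : ∀ x n f → x * sum n f ≈ sum n (λ i → x * f i)
  *-sum x zero    f = zeroʳ x
  *-sum x (suc n) f = trans (distribˡ x _ _) (+-congˡ (*-sum x n (f ∘ suc)))

  omitted : ℕ → (ℕ → Carrier) → Carrier
  omitted = omit _+_ _*_ 0# 1#

  omitted-cong : ∀ n {f f′} → (∀ i → i ℕ.< n → f i ≈ f′ i) → omitted n f ≈ omitted n f′
  omitted-cong zero    e = refl
  omitted-cong (suc n) e = +-cong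
    (*-cong (e 0 (ℕ.s≤s ℕ.z≤n)) (omitted-cong n λ i i<n → e (suc i) (ℕ.s≤s i<n)))
    (Π.cong-< n λ i i<n → e (suc i) (ℕ.s≤s i<n))

  prod-scale : ∀ n c f → prod n (λ i → c * f i) ≈ pow n c * prod n f
  prod-scale n c f = Π.zip n (const c) f

  -- `omitted n` is homogeneous of degree n - 1. The extra factor `c` on the left raises the degree
  -- to n and avoids a predecessor in the exponent.
  omitted-scale : ∀ n c f → c * omitted n (λ i → c * f i) ≈ pow n c * omitted n f
  omitted-scale zero    c f = trans (zeroʳ c) (sym (zeroʳ 1#))
  omitted-scale (suc n) c f = begin
    c * (c * f 0 * omitted n (λ i → c * f (suc i)) + prod n (λ i → c * f (suc i)))
      ≈⟨ *-congˡ (+-congˡ (prod-scale n c (f ∘ suc))) ⟩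
    c * (c * f 0 * omitted n (λ i → c * f (suc i)) + pow n c * prod n (f ∘ suc))
      ≈⟨ ring-solve 5 (λ c x o y z → (c :* (c :* x :* o :+ y :* z)) := (c :* x :* (c :* o) :+ c :* y :* z))
           refl c (f 0) _ (pow n c) (prod n (f ∘ suc)) ⟩
    c * f 0 * (c * omitted n (λ i → c * f (suc i))) + c * pow n c * prod n (f ∘ suc)
      ≈⟨ +-congʳ (*-congˡ (omitted-scale n c (f ∘ suc))) ⟩
    c * f 0 * (pow n c * omitted n (f ∘ suc)) + c * pow n c * prod n (f ∘ suc)
      ≈⟨ ring-solve 5 (λ c x o y z → (c :* x :* (y :* o) :+ c :* y :* z) := (c :* y :* (x :* o :+ z)))
           refl c (f 0) (omitted n (f ∘ suc)) (pow n c) (prod n (f ∘ suc)) ⟩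
    c * pow n c * (f 0 * omitted n (f ∘ suc) + prod n (f ∘ suc)) ∎

  -- Taylor expansion in `u`, which stops after the linear term since `u` squares to zero. The
  -- number of factors is `suc n` so that the linear term can carry the exponent `n` of `z`.
  prod-linear : ∀ n f z u → u * u ≈ 0# →
    prod (suc n) (λ i → f i * z + u) ≈
    prod (suc n) f * pow (suc n) z + omitted (suc n) f * pow n z * u
  prod-linear zero f z u u²≈0 = ring-solve 3
    (λ x z u → ((x :* z :+ u) :* con 1) :=
      (x :* con 1 :* (z :* con 1) :+ (x :* con 0 :+ con 1) :* con 1 :* u)) refl (f 0) z u
  prod-linear (suc n) f z u u²≈0 = begin
    (f 0 * z + u) * prod (suc n) (λ i → f (suc i) * z + u)
      ≈⟨ *-congˡ (prod-linear n (f ∘ suc) z u u²≈0) ⟩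
    (x * z + u) * (E * (z * Z) + e * Z * u)
      ≈⟨ ring-solve 6 (λ x z u E e Z → ((x :* z :+ u) :* (E :* (z :* Z) :+ e :* Z :* u)) :=
           (x :* E :* (z :* (z :* Z)) :+ (x :* e :+ E) :* (z :* Z) :* u :+ e :* Z :* (u :* u))) refl x z u E e Z ⟩
    x * E * (z * (z * Z)) + (x * e + E) * (z * Z) * u + e * Z * (u * u)
      ≈⟨ +-congˡ (trans (*-congˡ u²≈0) (zeroʳ _)) ⟩
    x * E * (z * (z * Z)) + (x * e + E) * (z * Z) * u + 0#
      ≈⟨ +-identityʳ _ ⟩
    x * E * (z * (z * Z)) + (x * e + E) * (z * Z) * u ∎
    where
    x E e Z : Carrier
    x = f 0
    E = prod (suc n) (f ∘ suc)
    e = omitted (suc n) (f ∘ suc)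
    Z = pow n z

  -- The reordering used in `v-factor`, stated for ring variables because there the letters are
  -- large products of series.
  rearrange : ∀ w c d a b x y →
    w * (c * d * (a * (y * (b * (c * x))))) ≈ c * c * (d * y) * (x * (b * (w * a)))
  rearrange = ring-solve 7 (λ w c d a b x y →
    (w :* (c :* d :* (a :* (y :* (b :* (c :* x)))))) := (c :* c :* (d :* y) :* (x :* (b :* (w :* a))))) refl

-- Formal power series over a commutative ring

module PowerSeries (R : CommutativeRing 0ℓ 0ℓ) where
  private module R = Ring R
  open R using (Carrier; _≈_; _+_; _*_; 0#; 1#; +-cong; +-congˡ; *-cong; refl; sym; trans)

  PS : Set
  PS = ℕ → Carrier

  infixl 7 _⋆_

  _⋆_ : PS → PS → PS
  _⋆_ = convolve _+_ _*_

  K : Carrier → PS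
  K = constant 0#

  ⋆-cong : ∀ {f f′ g g′} → (∀ k → f k ≈ f′ k) → (∀ k → g k ≈ g′ k) → ∀ k → (f ⋆ g) k ≈ (f′ ⋆ g′) k
  ⋆-cong e e′ zero    = *-cong (e 0) (e′ 0)
  ⋆-cong e e′ (suc k) = +-cong (*-cong (e 0) (e′ (suc k))) (⋆-cong (e ∘ suc) e′ k)

  -- Convolution recurses on its left argument. This is the mirror recursion on the right one, which
  -- the induction for commutativity requires.
  ⋆-suc : ∀ f g k → (f ⋆ g) (suc k) ≈ (f ⋆ (g ∘ suc)) k + f (suc k) * g 0
  ⋆-suc f g zero    = refl
  ⋆-suc f g (suc k) = trans (+-congˡ (⋆-suc (f ∘ suc) g k)) (sym (R.+-assoc _ _ _))

  ⋆-comm : ∀ f g k → (f ⋆ g) k ≈ (g ⋆ f) k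
  ⋆-comm f g zero    = R.*-comm _ _
  ⋆-comm f g (suc k) = trans (R.+-comm _ _)
    (trans (+-cong (⋆-comm (f ∘ suc) g k) (R.*-comm _ _)) (sym (⋆-suc g f k)))

  ⋆-distribʳ : ∀ h f g k → ((λ i → f i + g i) ⋆ h) k ≈ (f ⋆ h) k + (g ⋆ h) k
  ⋆-distribʳ h f g zero    = R.distribʳ _ _ _
  ⋆-distribʳ h f g (suc k) =
    trans (+-cong (R.distribʳ _ _ _) (⋆-distribʳ h (f ∘ suc) (g ∘ suc) k)) (R.Σ.interchange _ _ _ _)

  ⋆-scale : ∀ c f g k → ((λ i → c * f i) ⋆ g) k ≈ c * (f ⋆ g) k
  ⋆-scale c f g zero    = R.*-assoc _ _ _
  ⋆-scale c f g (suc k) =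
    trans (+-cong (R.*-assoc _ _ _) (⋆-scale c (f ∘ suc) g k)) (sym (R.distribˡ _ _ _))

  ⋆-assoc : ∀ f g h k → ((f ⋆ g) ⋆ h) k ≈ (f ⋆ (g ⋆ h)) k
  ⋆-assoc f g h zero    = R.*-assoc _ _ _
  ⋆-assoc f g h (suc k) = begin
    (f 0 * g 0) * h (suc k) + ((λ i → f 0 * g (suc i) + ((f ∘ suc) ⋆ g) i) ⋆ h) k
      ≈⟨ +-cong (R.*-assoc _ _ _) (⋆-distribʳ h _ _ k) ⟩
    f 0 * (g 0 * h (suc k)) + (((λ i → f 0 * g (suc i)) ⋆ h) k + (((f ∘ suc) ⋆ g) ⋆ h) k)
      ≈⟨ +-congˡ (+-cong (⋆-scale _ _ _ k) (⋆-assoc (f ∘ suc) g h k)) ⟩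
    f 0 * (g 0 * h (suc k)) + (f 0 * ((g ∘ suc) ⋆ h) k + ((f ∘ suc) ⋆ (g ⋆ h)) k)
      ≈⟨ sym (R.+-assoc _ _ _) ⟩
    (f 0 * (g 0 * h (suc k)) + f 0 * ((g ∘ suc) ⋆ h) k) + ((f ∘ suc) ⋆ (g ⋆ h)) k
      ≈⟨ R.+-congʳ (sym (R.distribˡ _ _ _)) ⟩
    f 0 * (g ⋆ h) (suc k) + ((f ∘ suc) ⋆ (g ⋆ h)) k ∎
    where open R using (begin_; step-≈-⟩; _∎)

  ⋆-zeroˡ : ∀ g k → ((λ _ → 0#) ⋆ g) k ≈ 0#
  ⋆-zeroˡ g zero    = R.zeroˡ _
  ⋆-zeroˡ g (suc k) = trans (+-cong (R.zeroˡ _) (⋆-zeroˡ g k)) (R.+-identityˡ _)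

  ⋆-identityˡ : ∀ g k → (K 1# ⋆ g) k ≈ g k
  ⋆-identityˡ g zero    = R.*-identityˡ _
  ⋆-identityˡ g (suc k) = trans (+-cong (R.*-identityˡ _) (⋆-zeroˡ g k)) (R.+-identityʳ _)

  K-cong : ∀ {a b} → a ≈ b → ∀ k → K a k ≈ K b k
  K-cong e zero    = e
  K-cong e (suc k) = refl

  ⋆-sum : ∀ f g k → (f ⋆ g) k ≈ R.sum (suc k) (λ j → f j * g (k ℕ.∸ j))
  ⋆-sum f g zero    = sym (R.+-identityʳ _)
  ⋆-sum f g (suc k) = +-congˡ (⋆-sum (f ∘ suc) g k)

  K-⋆ : ∀ c g k → (K c ⋆ g) k ≈ c * g k
  K-⋆ c g zero    = refl
  K-⋆ c g (suc k) = trans (+-congˡ (⋆-zeroˡ g k)) (R.+-identityʳ _)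

  linear-⋆ : ∀ a b g k → (linear 0# a b ⋆ g) (suc k) ≈ a * g (suc k) + b * g k
  linear-⋆ a b g k = +-congˡ (K-⋆ b g k)

  K-* : ∀ a b k → K (a * b) k ≈ (K a ⋆ K b) k
  K-* a b zero    = refl
  K-* a b (suc k) = sym (trans (K-⋆ a (K b) (suc k)) (R.zeroʳ a))

  K-+ : ∀ a b k → K (a + b) k ≈ K a k + K b k
  K-+ a b zero    = refl
  K-+ a b (suc k) = sym (R.+-identityʳ 0#)

  linear-cong : ∀ {a a′ b b′} → a ≈ a′ → b ≈ b′ → ∀ k → linear 0# a b k ≈ linear 0# a′ b′ k
  linear-cong e e′ zero    = e
  linear-cong e e′ (suc k) = K-cong e′ k

  powerSeries : CommutativeRing 0ℓ 0ℓ
  powerSeries = record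
    { Carrier = PS
    ; _≈_ = λ f g → ∀ k → f k ≈ g k
    ; _+_ = λ f g k → f k + g k
    ; _*_ = _⋆_
    ; -_  = λ f k → R.- f k
    ; 0#  = λ _ → 0#
    ; 1#  = K 1#
    ; isCommutativeRing = record
      { isRing = record
        { +-isAbelianGroup = Pointwise.isAbelianGroup ℕ R.+-isAbelianGroup
        ; *-cong = ⋆-cong
        ; *-assoc = ⋆-assoc
        ; *-identity = ⋆-identityˡ , λ g k → trans (⋆-comm g (K 1#) k) (⋆-identityˡ g k)
        ; distrib =
            (λ h f g k → trans (⋆-comm h _ k)
              (trans (⋆-distribʳ h f g k) (+-cong (⋆-comm f h k) (⋆-comm g h k))))
          , ⋆-distribʳ
        }
      ; *-comm = ⋆-comm
      }
    }

  private module S = Ring powerSeries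

  K-prod : ∀ n f k → K (R.prod n f) k ≈ S.prod n (K ∘ f) k
  K-prod zero    f k = refl
  K-prod (suc n) f k = trans (K-* (f 0) _ k) (⋆-cong (λ _ → refl) (K-prod n (f ∘ suc)) k)

  K-omitted : ∀ n f k → K (R.omitted n f) k ≈ S.omitted n (K ∘ f) k
  K-omitted zero    f zero    = refl
  K-omitted zero    f (suc k) = refl
  K-omitted (suc n) f k = trans (K-+ _ _ k) (+-cong
    (trans (K-* (f 0) _ k) (⋆-cong (λ _ → refl) (K-omitted n (f ∘ suc)) k))
    (K-prod n (f ∘ suc) k))

-- The integers modulo m as a commutative ring

infix 4 _≡_[_]

-- Keeping the quotient as data lets a match on `mod k refl` replace `x` by `y + m k`, so that each
-- closure property becomes a polynomial identity.
record _≡_[_] (x y : ℤ) (m : ℤ) : Set where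
  constructor mod
  field
    quot  : ℤ
    equal : x ≡ y ℤ.+ m ℤ.* quot

ℤmod : ℤ → CommutativeRing 0ℓ 0ℓ
ℤmod m = record
  { Carrier = ℤ
  ; _≈_ = λ x y → x ≡ y [ m ]
  ; _+_ = ℤ._+_
  ; _*_ = ℤ._*_
  ; -_  = -_
  ; 0#  = + 0
  ; 1#  = + 1
  ; isCommutativeRing = record
    { isRing = record
      { +-isAbelianGroup = record
        { isGroup = record
          { isMonoid = record
            { isSemigroup = record
              { isMagma = record
                { isEquivalence = record
                  { refl  = exact ≡.refl
                  ; sym   = λ { {x} {y} (mod k ≡.refl) → mod (- k) (lem₁ y m k) }
                  ; trans = λ { {x} {y} {z} (mod k ≡.refl) (mod l ≡.refl) → mod (l ℤ.+ k) (lem₂ z m k l) }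
                  }
                ; ∙-cong = λ { {x} {y} {u} {v} (mod k ≡.refl) (mod l ≡.refl) → mod (k ℤ.+ l) (lem₃ y v m k l) }
                }
              ; assoc = λ x y z → exact (ℤP.+-assoc x y z)
              }
            ; identity = (λ x → exact (ℤP.+-identityˡ x)) , (λ x → exact (ℤP.+-identityʳ x))
            }
          ; inverse = (λ x → exact (ℤP.+-inverseˡ x)) , (λ x → exact (ℤP.+-inverseʳ x))
          ; ⁻¹-cong = λ { {x} {y} (mod k ≡.refl) → mod (- k) (lem₄ y m k) }
          }
        ; comm = λ x y → exact (ℤP.+-comm x y)
        }
      ; *-cong = λ { {x} {y} {u} {v} (mod k ≡.refl) (mod l ≡.refl) →
                     mod (y ℤ.* l ℤ.+ k ℤ.* v ℤ.+ m ℤ.* k ℤ.* l) (lem₅ y v m k l) }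
      ; *-assoc = λ x y z → exact (ℤP.*-assoc x y z)
      ; *-identity = (λ x → exact (ℤP.*-identityˡ x)) , (λ x → exact (ℤP.*-identityʳ x))
      ; distrib = (λ x y z → exact (ℤP.*-distribˡ-+ x y z)) , (λ x y z → exact (ℤP.*-distribʳ-+ x y z))
      }
    ; *-comm = λ x y → exact (ℤP.*-comm x y)
    }
  }
  where
  exact : ∀ {x y} → x ≡ y → x ≡ y [ m ]
  exact {x} ≡.refl = mod (+ 0) (lem₀ x m)
    where
    lem₀ : ∀ x m → x ≡ x ℤ.+ m ℤ.* + 0
    lem₀ = solve-∀
  lem₁ : ∀ y m k → y ≡ y ℤ.+ m ℤ.* k ℤ.+ m ℤ.* - k
  lem₁ = solve-∀
  lem₂ : ∀ z m k l → z ℤ.+ m ℤ.* l ℤ.+ m ℤ.* k ≡ z ℤ.+ m ℤ.* (l ℤ.+ k)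
  lem₂ = solve-∀
  lem₃ : ∀ y v m k l → (y ℤ.+ m ℤ.* k) ℤ.+ (v ℤ.+ m ℤ.* l) ≡ y ℤ.+ v ℤ.+ m ℤ.* (k ℤ.+ l)
  lem₃ = solve-∀
  lem₄ : ∀ y m k → - (y ℤ.+ m ℤ.* k) ≡ - y ℤ.+ m ℤ.* - k
  lem₄ = solve-∀
  lem₅ : ∀ y v m k l → (y ℤ.+ m ℤ.* k) ℤ.* (v ℤ.+ m ℤ.* l) ≡
         y ℤ.* v ℤ.+ m ℤ.* (y ℤ.* l ℤ.+ k ℤ.* v ℤ.+ m ℤ.* k ℤ.* l)
  lem₅ = solve-∀

-- From coefficient lists to power series over the integers

module Z = Ring ℤP.+-*-commutativeRing

coeffs : Poly → ℕ → ℤ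
coeffs p k = coeff k p

Linear : ℤ → ℤ → ℕ → ℤ
Linear = linear (+ 0)

W X : ℕ → ℤ
W = Linear (+ 1) (- + 1)
X = Linear (+ 0) (+ 1)

coeffs-lin : ∀ a b k → coeffs (lin a b) k ≡ Linear a b k
coeffs-lin a b zero          = ≡.refl
coeffs-lin a b (suc zero)    = ≡.refl
coeffs-lin a b (suc (suc k)) = ≡.refl

coeffs-⊕ : ∀ p q k → coeffs (p ⊕ q) k ≡ coeffs p k ℤ.+ coeffs q k
coeffs-⊕ []      q       k       = ≡.sym (ℤP.+-identityˡ _)
coeffs-⊕ (a ∷ p) []      k       = ≡.sym (ℤP.+-identityʳ _)
coeffs-⊕ (a ∷ p) (b ∷ q) zero    = ≡.refl
coeffs-⊕ (a ∷ p) (b ∷ q) (suc k) = coeffs-⊕ p q k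

coeffs-scale : ∀ c q k → coeffs (scale c q) k ≡ c ℤ.* coeffs q k
coeffs-scale c []      k       = ≡.sym (ℤP.*-zeroʳ c)
coeffs-scale c (b ∷ q) zero    = ≡.refl
coeffs-scale c (b ∷ q) (suc k) = coeffs-scale c q k

module PSℤ = PowerSeries ℤP.+-*-commutativeRing
open PSℤ using (_⋆_; K) public
module S = Ring PSℤ.powerSeries

coeffs-⊛ : ∀ p q k → coeffs (p ⊛ q) k ≡ (coeffs p ⋆ coeffs q) k
coeffs-⊛ []      q k       = ≡.sym (PSℤ.⋆-zeroˡ (coeffs q) k)
coeffs-⊛ (a ∷ p) q zero    = ≡.trans (coeffs-⊕ (scale a q) _ 0)
  (≡.trans (ℤP.+-identityʳ _) (coeffs-scale a q 0))
coeffs-⊛ (a ∷ p) q (suc k) = ≡.trans (coeffs-⊕ (scale a q) _ (suc k))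
  (cong₂ ℤ._+_ (coeffs-scale a q (suc k)) (coeffs-⊛ p q k))

coeffs-prod : ∀ f n k → coeffs (prodP (map f (upTo n))) k ≡ S.prod n (coeffs ∘ f) k
coeffs-prod f n k = ≡.trans (cong (λ ps → coeffs (prodP ps) k) (map-upTo f n)) (go f n k)
  where
  go : ∀ f n k → coeffs (prodP (applyUpTo f n)) k ≡ S.prod n (coeffs ∘ f) k
  go f zero    zero    = ≡.refl
  go f zero    (suc k) = ≡.refl
  go f (suc n) k       = ≡.trans (coeffs-⊛ (f 0) _ k) (PSℤ.⋆-cong (λ _ → ≡.refl) (go (f ∘ suc) n) k)

dfact-prod : ∀ u a → dfact u a ≡ Z.prod a (λ i → u ℤ.+ + (2 ℕ.* i))
dfact-prod u = go id
  where
  go : ∀ f a → foldr (λ i acc → (u ℤ.+ + (2 ℕ.* i)) ℤ.* acc) (+ 1) (applyUpTo f a) ≡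
               Z.prod a (λ i → u ℤ.+ + (2 ℕ.* f i))
  go f zero    = ≡.refl
  go f (suc a) = cong ((u ℤ.+ + (2 ℕ.* f 0)) ℤ.*_) (go (f ∘ suc) a)

sumℤ-sum : ∀ f n → sumℤ (map f (upTo n)) ≡ Z.sum n f
sumℤ-sum f n = ≡.trans (cong sumℤ (map-upTo f n)) (go f n)
  where
  go : ∀ f n → sumℤ (applyUpTo f n) ≡ Z.sum n f
  go f zero    = ≡.refl
  go f (suc n) = cong (λ z → f 0 ℤ.+ z) (go (f ∘ suc) n)

-- Both sides are ab + (a² + b²) x + ab x²; the middle coefficient is split as (a + b)² - 2ab. When
-- a + b = p the correction to ab (1 - x)² is divisible by p².
linear-pair : ∀ a b k → (Linear a b ⋆ Linear b a) k ≡
  (K (a ℤ.* b) ⋆ (W ⋆ W)) k ℤ.+ (K ((a ℤ.+ b) ℤ.* (a ℤ.+ b)) ⋆ X) k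
linear-pair a b k = ≡.trans (go k)
    (≡.sym (cong₂ ℤ._+_ (PSℤ.K-⋆ (a ℤ.* b) (W ⋆ W) k) (PSℤ.K-⋆ ((a ℤ.+ b) ℤ.* (a ℤ.+ b)) X k)))
  where
  s = a ℤ.+ b
  lem : ∀ a b x y k → x ≡ a ℤ.* Linear b a (suc k) ℤ.+ b ℤ.* Linear b a k →
    y ≡ + 1 ℤ.* W (suc k) ℤ.+ - + 1 ℤ.* W k →
    x ≡ (a ℤ.* b) ℤ.* y ℤ.+ (a ℤ.+ b) ℤ.* (a ℤ.+ b) ℤ.* X (suc k)
  lem a b x y zero          ≡.refl ≡.refl = at-1 a b
    where
    at-1 : ∀ a b → a ℤ.* a ℤ.+ b ℤ.* b ≡
      a ℤ.* b ℤ.* (+ 1 ℤ.* - + 1 ℤ.+ - + 1 ℤ.* + 1) ℤ.+ (a ℤ.+ b) ℤ.* (a ℤ.+ b) ℤ.* + 1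
    at-1 = solve-∀
  lem a b x y (suc zero)    ≡.refl ≡.refl = at-2 a b
    where
    at-2 : ∀ a b → a ℤ.* + 0 ℤ.+ b ℤ.* a ≡
      a ℤ.* b ℤ.* (+ 1 ℤ.* + 0 ℤ.+ - + 1 ℤ.* - + 1) ℤ.+ (a ℤ.+ b) ℤ.* (a ℤ.+ b) ℤ.* + 0
    at-2 = solve-∀
  lem a b x y (suc (suc k)) ≡.refl ≡.refl = at-3 a b
    where
    at-3 : ∀ a b → a ℤ.* + 0 ℤ.+ b ℤ.* + 0 ≡
      a ℤ.* b ℤ.* (+ 1 ℤ.* + 0 ℤ.+ - + 1 ℤ.* + 0) ℤ.+ (a ℤ.+ b) ℤ.* (a ℤ.+ b) ℤ.* + 0
    at-3 = solve-∀
  go : ∀ k → (Linear a b ⋆ Linear b a) k ≡ (a ℤ.* b) ℤ.* (W ⋆ W) k ℤ.+ (s ℤ.* s) ℤ.* X k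
  go zero    = at-0 a b
    where
    at-0 : ∀ a b → a ℤ.* b ≡ (a ℤ.* b) ℤ.* (+ 1 ℤ.* + 1) ℤ.+ (a ℤ.+ b) ℤ.* (a ℤ.+ b) ℤ.* + 0
    at-0 = solve-∀
  go (suc k) = lem a b _ _ k (PSℤ.linear-⋆ a b (Linear b a) k) (PSℤ.linear-⋆ (+ 1) (- + 1) W k)

-- Signed binomial coefficients and finite differences

-- Reduces an equation to a multiple of a known one, leaving a single polynomial identity that the
-- ring solver can check.
linear-combination : ∀ {l r a b} c → l ≡ r → a - b ≡ c ℤ.* (l - r) → a ≡ b
linear-combination {l} {a = a} {b} c ≡.refl e = ℤP.i-j≡0⇒i≡j a b (≡.trans e
  (≡.trans (cong (c ℤ.*_) (ℤP.i≡j⇒i-j≡0 {l} ≡.refl)) (ℤP.*-zeroʳ c)))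

linear-combination₂ : ∀ {l r l′ r′ a b} c c′ → l ≡ r → l′ ≡ r′ →
  a - b ≡ c ℤ.* (l - r) ℤ.+ c′ ℤ.* (l′ - r′) → a ≡ b
linear-combination₂ {l} {r} {l′} {r′} {a} {b} c c′ e e′ s =
  linear-combination {l} {r} {a} {b} c e (≡.trans s (≡.trans
    (cong (λ z → c ℤ.* (l - r) ℤ.+ z)
      (≡.trans (cong (c′ ℤ.*_) (ℤP.i≡j⇒i-j≡0 e′)) (ℤP.*-zeroʳ c′)))
    (ℤP.+-identityʳ _)))

-- The signed binomial coefficient (-1)^k (n choose k).
binom : ℕ → ℕ → ℤ
binom zero    zero    = + 1
binom zero    (suc k) = + 0
binom (suc n) zero    = binom n zero
binom (suc n) (suc k) = binom n (suc k) - binom n k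

binom-zero : ∀ n → binom n 0 ≡ + 1
binom-zero zero    = ≡.refl
binom-zero (suc n) = binom-zero n

W-⋆ : ∀ f k → (W ⋆ f) (suc k) ≡ f (suc k) - f k
W-⋆ f k = ≡.trans (PSℤ.linear-⋆ (+ 1) (- + 1) f k) (lem (f (suc k)) (f k))
  where
  lem : ∀ x y → + 1 ℤ.* x ℤ.+ - + 1 ℤ.* y ≡ x - y
  lem = solve-∀

W-⋆-zero : ∀ f → (W ⋆ f) 0 ≡ f 0
W-⋆-zero f = ℤP.*-identityˡ (f 0)

W-pow : ∀ n k → S.pow n W k ≡ binom n k
W-pow zero    zero    = ≡.refl
W-pow zero    (suc k) = ≡.refl
W-pow (suc n) zero    = ≡.trans (W-⋆-zero (S.pow n W)) (W-pow n 0)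
W-pow (suc n) (suc k) = ≡.trans (W-⋆ (S.pow n W) k) (cong₂ _-_ (W-pow n (suc k)) (W-pow n k))

-- The sign (-1)^k turns the usual factor n - k into k - n. By induction on n: the instances at k +
-- 1 and k of the previous row combine through Pascal's rule.
binom-absorb : ∀ n k → + suc k ℤ.* binom n (suc k) ≡ (+ k - + n) ℤ.* binom n k
binom-absorb zero    zero    = ≡.refl
binom-absorb zero    (suc k) = ≡.trans (ℤP.*-zeroʳ (+ suc (suc k))) (≡.sym (ℤP.*-zeroʳ (+ suc k - + 0)))
binom-absorb (suc n) zero    =
  linear-combination {+ 1 ℤ.* binom n 1} {(+ 0 - + n) ℤ.* binom n 0} (+ 1) (binom-absorb n 0)
    (lem (+ n) (binom n 1) (binom n 0))
  where
  lem : ∀ n u v → + 1 ℤ.* (u - v) - (+ 0 - (+ 1 ℤ.+ n)) ℤ.* v ≡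
    + 1 ℤ.* (+ 1 ℤ.* u - (+ 0 - n) ℤ.* v)
  lem = solve-∀
binom-absorb (suc n) (suc k) =
  linear-combination₂ {+ suc (suc k) ℤ.* binom n (suc (suc k))} {(+ suc k - + n) ℤ.* binom n (suc k)}
           {+ suc k ℤ.* binom n (suc k)} {(+ k - + n) ℤ.* binom n k}
    (+ 1) (- + 1) (binom-absorb n (suc k)) (binom-absorb n k)
    (lem (+ n) (+ k) (binom n (suc (suc k))) (binom n (suc k)) (binom n k))
  where
  lem : ∀ n k u v t →
    (+ 2 ℤ.+ k) ℤ.* (u - v) - (+ 1 ℤ.+ k - (+ 1 ℤ.+ n)) ℤ.* (v - t) ≡
    + 1 ℤ.* ((+ 2 ℤ.+ k) ℤ.* u - (+ 1 ℤ.+ k - n) ℤ.* v) ℤ.+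
    - + 1 ℤ.* ((+ 1 ℤ.+ k) ℤ.* v - (k - n) ℤ.* t)
  lem = solve-∀

binom-climb : ∀ n k → (+ suc n - + k) ℤ.* binom (suc n) k ≡ + suc n ℤ.* binom n k
binom-climb n zero    = cong (ℤ._* binom n 0) (ℤP.+-identityʳ (+ suc n))
binom-climb n (suc k) =
  linear-combination {+ suc k ℤ.* binom n (suc k)} {(+ k - + n) ℤ.* binom n k} (- + 1) (binom-absorb n k)
    (lem (+ n) (+ k) (binom n (suc k)) (binom n k))
  where
  lem : ∀ n k u v →
    (+ 1 ℤ.+ n - (+ 1 ℤ.+ k)) ℤ.* (u - v) - (+ 1 ℤ.+ n) ℤ.* u ≡
    - + 1 ℤ.* ((+ 1 ℤ.+ k) ℤ.* u - (k - n) ℤ.* v)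
  lem = solve-∀

binom-rise : ∀ s n k →
  Z.prod s (λ i → + suc (i ℕ.+ n) - + k) ℤ.* binom (s ℕ.+ n) k ≡
  Z.prod s (λ i → + suc (i ℕ.+ n)) ℤ.* binom n k
binom-rise zero    n k = ≡.refl
binom-rise (suc s) n k = begin
  Z.prod (suc s) f ℤ.* binom (suc s ℕ.+ n) k
    ≡⟨ cong (ℤ._* binom (suc s ℕ.+ n) k) (Z.Π.snoc s f) ⟩
  Z.prod s f ℤ.* f s ℤ.* binom (suc s ℕ.+ n) k
    ≡⟨ ℤP.*-assoc (Z.prod s f) (f s) _ ⟩
  Z.prod s f ℤ.* (f s ℤ.* binom (suc s ℕ.+ n) k)
    ≡⟨ cong (Z.prod s f ℤ.*_) (binom-climb (s ℕ.+ n) k) ⟩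
  Z.prod s f ℤ.* (g s ℤ.* binom (s ℕ.+ n) k)
    ≡⟨ swap (Z.prod s f) (g s) _ ⟩
  Z.prod s f ℤ.* binom (s ℕ.+ n) k ℤ.* g s
    ≡⟨ cong (ℤ._* g s) (binom-rise s n k) ⟩
  Z.prod s g ℤ.* binom n k ℤ.* g s
    ≡⟨ swap′ (Z.prod s g) (g s) _ ⟩
  Z.prod s g ℤ.* g s ℤ.* binom n k
    ≡⟨ cong (ℤ._* binom n k) (≡.sym (Z.Π.snoc s g)) ⟩
  Z.prod (suc s) g ℤ.* binom n k ∎
  where
  open ≡.≡-Reasoning
  f g : ℕ → ℤ
  f i = + suc (i ℕ.+ n) - + k
  g i = + suc (i ℕ.+ n)
  swap : ∀ x y z → x ℤ.* (y ℤ.* z) ≡ x ℤ.* z ℤ.* y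
  swap = solve-∀
  swap′ : ∀ x y z → x ℤ.* z ℤ.* y ≡ x ℤ.* y ℤ.* z
  swap′ = solve-∀

-- Multiplication by (1 - x)^n is the n-th finite difference.
W-pow-suc : ∀ n f k → (S.pow (suc n) W ⋆ f) (suc k) ≡ (S.pow n W ⋆ f) (suc k) - (S.pow n W ⋆ f) k
W-pow-suc n f k = ≡.trans (PSℤ.⋆-assoc W (S.pow n W) f (suc k)) (W-⋆ (S.pow n W ⋆ f) k)

W-pow-zero : ∀ n f → (S.pow n W ⋆ f) 0 ≡ f 0
W-pow-zero zero    f = PSℤ.⋆-identityˡ f 0
W-pow-zero (suc n) f = ≡.trans (PSℤ.⋆-assoc W (S.pow n W) f 0)
  (≡.trans (W-⋆-zero (S.pow n W ⋆ f)) (W-pow-zero n f))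

-- Below index n the convolution treats the missing values at negative arguments as 0 and is not a
-- full n-th difference; hence the index `n + k`.
difference-geometric : ∀ a n k →
  (S.pow n W ⋆ λ i → Z.pow i a) (n ℕ.+ k) ≡ Z.pow n (a - + 1) ℤ.* Z.pow k a
difference-geometric a zero    k = ≡.trans (PSℤ.⋆-identityˡ _ k) (≡.sym (ℤP.*-identityˡ _))
difference-geometric a (suc n) k = begin
  (S.pow (suc n) W ⋆ G) (suc n ℕ.+ k)
    ≡⟨ W-pow-suc n G (n ℕ.+ k) ⟩
  (S.pow n W ⋆ G) (suc (n ℕ.+ k)) - (S.pow n W ⋆ G) (n ℕ.+ k)
    ≡⟨ cong (λ i → (S.pow n W ⋆ G) i - (S.pow n W ⋆ G) (n ℕ.+ k)) (≡.sym (ℕP.+-suc n k)) ⟩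
  (S.pow n W ⋆ G) (n ℕ.+ suc k) - (S.pow n W ⋆ G) (n ℕ.+ k)
    ≡⟨ cong₂ _-_ (difference-geometric a n (suc k)) (difference-geometric a n k) ⟩
  Z.pow n (a - + 1) ℤ.* (a ℤ.* Z.pow k a) - Z.pow n (a - + 1) ℤ.* Z.pow k a
    ≡⟨ lem a (Z.pow n (a - + 1)) (Z.pow k a) ⟩
  (a - + 1) ℤ.* Z.pow n (a - + 1) ℤ.* Z.pow k a ∎
  where
  open ≡.≡-Reasoning
  G = λ i → Z.pow i a
  lem : ∀ a x y → x ℤ.* (a ℤ.* y) - x ℤ.* y ≡ (a - + 1) ℤ.* x ℤ.* y
  lem = solve-∀

-- Leibniz rule: x d/dx multiplies the i-th coefficient by i and is a derivation, and it sends
-- w^(n+1) to -(n+1) x w^n.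
difference-product : ∀ n f k → (S.pow (suc n) W ⋆ λ i → + i ℤ.* f i) (suc k) ≡
  + suc k ℤ.* (S.pow (suc n) W ⋆ f) (suc k) ℤ.+ + suc n ℤ.* (S.pow n W ⋆ f) k
difference-product n f k = go n k
  where
  open ≡.≡-Reasoning
  θf : ℕ → ℤ
  θf i = + i ℤ.* f i
  lem₀ : ∀ k x y → (+ 1 ℤ.+ k) ℤ.* x - k ℤ.* y ≡ (+ 1 ℤ.+ k) ℤ.* (x - y) ℤ.+ + 1 ℤ.* y
  lem₀ = solve-∀
  lem₁ : ∀ n x y z → z ≡ y → + 1 ℤ.* x ℤ.+ (+ 1 ℤ.+ n) ℤ.* y - + 0 ≡
    + 1 ℤ.* (x - z) ℤ.+ (+ 2 ℤ.+ n) ℤ.* z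
  lem₁ n x y _ ≡.refl = lem n x y
    where
    lem : ∀ n x y → + 1 ℤ.* x ℤ.+ (+ 1 ℤ.+ n) ℤ.* y - + 0 ≡ + 1 ℤ.* (x - y) ℤ.+ (+ 2 ℤ.+ n) ℤ.* y
    lem = solve-∀
  lem₂ : ∀ n k x y u v → y ≡ u - v →
    (+ 2 ℤ.+ k) ℤ.* x ℤ.+ (+ 1 ℤ.+ n) ℤ.* u - ((+ 1 ℤ.+ k) ℤ.* y ℤ.+ (+ 1 ℤ.+ n) ℤ.* v) ≡
    (+ 2 ℤ.+ k) ℤ.* (x - y) ℤ.+ (+ 2 ℤ.+ n) ℤ.* y
  lem₂ n k x _ u v ≡.refl = lem n k x u v
    where
    lem : ∀ n k x u v →
      (+ 2 ℤ.+ k) ℤ.* x ℤ.+ (+ 1 ℤ.+ n) ℤ.* u - ((+ 1 ℤ.+ k) ℤ.* (u - v) ℤ.+ (+ 1 ℤ.+ n) ℤ.* v) ≡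
      (+ 2 ℤ.+ k) ℤ.* (x - (u - v)) ℤ.+ (+ 2 ℤ.+ n) ℤ.* (u - v)
    lem = solve-∀
  go : ∀ n k → (S.pow (suc n) W ⋆ θf) (suc k) ≡
    + suc k ℤ.* (S.pow (suc n) W ⋆ f) (suc k) ℤ.+ + suc n ℤ.* (S.pow n W ⋆ f) k
  go zero k = begin
    (S.pow 1 W ⋆ θf) (suc k)
      ≡⟨ W-pow-suc 0 θf k ⟩
    (K (+ 1) ⋆ θf) (suc k) - (K (+ 1) ⋆ θf) k
      ≡⟨ cong₂ _-_ (PSℤ.⋆-identityˡ θf (suc k)) (PSℤ.⋆-identityˡ θf k) ⟩
    + suc k ℤ.* f (suc k) - + k ℤ.* f k
      ≡⟨ lem₀ (+ k) (f (suc k)) (f k) ⟩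
    + suc k ℤ.* (f (suc k) - f k) ℤ.+ + 1 ℤ.* f k
      ≡⟨ cong₂ (λ x y → + suc k ℤ.* x ℤ.+ + 1 ℤ.* y)
           (≡.sym (≡.trans (W-pow-suc 0 f k) (cong₂ _-_ (PSℤ.⋆-identityˡ f (suc k)) (PSℤ.⋆-identityˡ f k))))
           (≡.sym (PSℤ.⋆-identityˡ f k)) ⟩
    + suc k ℤ.* (S.pow 1 W ⋆ f) (suc k) ℤ.+ + 1 ℤ.* (S.pow 0 W ⋆ f) k ∎
  go (suc n) zero = begin
    (S.pow (suc (suc n)) W ⋆ θf) 1
      ≡⟨ W-pow-suc (suc n) θf 0 ⟩
    (S.pow (suc n) W ⋆ θf) 1 - (S.pow (suc n) W ⋆ θf) 0
      ≡⟨ cong₂ _-_ (go n 0) (W-pow-zero (suc n) θf) ⟩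
    + 1 ℤ.* A₁ 1 ℤ.+ + suc n ℤ.* A₀ 0 - + 0
      ≡⟨ lem₁ (+ n) (A₁ 1) (A₀ 0) (A₁ 0) (≡.trans (W-pow-zero (suc n) f) (≡.sym (W-pow-zero n f))) ⟩
    + 1 ℤ.* (A₁ 1 - A₁ 0) ℤ.+ + suc (suc n) ℤ.* A₁ 0
      ≡⟨ cong (λ x → + 1 ℤ.* x ℤ.+ + suc (suc n) ℤ.* A₁ 0) (≡.sym (W-pow-suc (suc n) f 0)) ⟩
    + 1 ℤ.* (S.pow (suc (suc n)) W ⋆ f) 1 ℤ.+ + suc (suc n) ℤ.* A₁ 0 ∎
    where
    A₀ A₁ : ℕ → ℤ
    A₀ = S.pow n W ⋆ f
    A₁ = S.pow (suc n) W ⋆ f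
  go (suc n) (suc k) = begin
    (S.pow (suc (suc n)) W ⋆ θf) (suc (suc k))
      ≡⟨ W-pow-suc (suc n) θf (suc k) ⟩
    (S.pow (suc n) W ⋆ θf) (suc (suc k)) - (S.pow (suc n) W ⋆ θf) (suc k)
      ≡⟨ cong₂ _-_ (go n (suc k)) (go n k) ⟩
    + suc (suc k) ℤ.* A₁ (suc (suc k)) ℤ.+ + suc n ℤ.* A₀ (suc k)
      - (+ suc k ℤ.* A₁ (suc k) ℤ.+ + suc n ℤ.* A₀ k)
      ≡⟨ lem₂ (+ n) (+ k) (A₁ (suc (suc k))) (A₁ (suc k)) (A₀ (suc k)) (A₀ k) (W-pow-suc n f k) ⟩
    + suc (suc k) ℤ.* (A₁ (suc (suc k)) - A₁ (suc k)) ℤ.+ + suc (suc n) ℤ.* A₁ (suc k)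
      ≡⟨ cong (λ x → + suc (suc k) ℤ.* x ℤ.+ + suc (suc n) ℤ.* A₁ (suc k)) (≡.sym (W-pow-suc (suc n) f (suc k))) ⟩
    + suc (suc k) ℤ.* (S.pow (suc (suc n)) W ⋆ f) (suc (suc k)) ℤ.+ + suc (suc n) ℤ.* A₁ (suc k) ∎
    where
    A₀ A₁ : ℕ → ℤ
    A₀ = S.pow n W ⋆ f
    A₁ = S.pow (suc n) W ⋆ f

-- Induction through `difference-product` applied to i · i^n: the n-th difference of i^n is already
-- constant, so its next difference vanishes and only (n + 1) · n! survives.
difference-power : ∀ n k → (S.pow n W ⋆ λ i → Z.pow n (+ i)) (n ℕ.+ k) ≡ + (n !)
difference-power zero    k = PSℤ.⋆-identityˡ _ k
difference-power (suc n) k = begin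
  (S.pow (suc n) W ⋆ λ i → + i ℤ.* G i) (suc (n ℕ.+ k))
    ≡⟨ difference-product n G (n ℕ.+ k) ⟩
  + suc (n ℕ.+ k) ℤ.* (S.pow (suc n) W ⋆ G) (suc (n ℕ.+ k)) ℤ.+ + suc n ℤ.* (S.pow n W ⋆ G) (n ℕ.+ k)
    ≡⟨ cong₂ (λ x y → + suc (n ℕ.+ k) ℤ.* x ℤ.+ + suc n ℤ.* y) vanish (difference-power n k) ⟩
  + suc (n ℕ.+ k) ℤ.* + 0 ℤ.+ + suc n ℤ.* + (n !)
    ≡⟨ cong (ℤ._+ + suc n ℤ.* + (n !)) (ℤP.*-zeroʳ (+ suc (n ℕ.+ k))) ⟩
  + 0 ℤ.+ + suc n ℤ.* + (n !)
    ≡⟨ ℤP.+-identityˡ _ ⟩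
  + suc n ℤ.* + (n !)
    ≡⟨ ≡.sym (ℤP.pos-* (suc n) (n !)) ⟩
  + (suc n !) ∎
  where
  open ≡.≡-Reasoning
  G : ℕ → ℤ
  G i = Z.pow n (+ i)
  vanish : (S.pow (suc n) W ⋆ G) (suc (n ℕ.+ k)) ≡ + 0
  vanish = ≡.trans (W-pow-suc n G (n ℕ.+ k)) (ℤP.i≡j⇒i-j≡0
    (≡.trans (≡.trans (cong (S.pow n W ⋆ G) (≡.sym (ℕP.+-suc n k))) (difference-power n (suc k)))
             (≡.sym (difference-power n k))))

-- Congruences

mod⇒∣ : ∀ {x y m} → x ≡ y [ m ] → m Signed.∣ (x - y)
mod⇒∣ {y = y} {m} (mod q ≡.refl) = divides q (lem y m q)
  where
  lem : ∀ y m q → y ℤ.+ m ℤ.* q - y ≡ q ℤ.* m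
  lem = solve-∀

∣⇒mod : ∀ {x y m} → m Signed.∣ (x - y) → x ≡ y [ m ]
∣⇒mod {x} {y} {m} (divides q e) = mod q (linear-combination {x - y} {q ℤ.* m} (+ 1) e (lem x y m q))
  where
  lem : ∀ x y m q → x - (y ℤ.+ m ℤ.* q) ≡ + 1 ℤ.* (x - y - q ℤ.* m)
  lem = solve-∀

mod-scale : ∀ {x y m} c → x ≡ y [ m ] → c ℤ.* x ≡ c ℤ.* y [ c ℤ.* m ]
mod-scale {y = y} {m} c (mod q ≡.refl) = mod q (lem c y m q)
  where
  lem : ∀ c y m q → c ℤ.* (y ℤ.+ m ℤ.* q) ≡ c ℤ.* y ℤ.+ c ℤ.* m ℤ.* q
  lem = solve-∀

mod-weaken : ∀ {x y m} c → x ≡ y [ c ℤ.* m ] → x ≡ y [ m ]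
mod-weaken {y = y} {m} c (mod q ≡.refl) = mod (c ℤ.* q) (lem c y m q)
  where
  lem : ∀ c y m q → y ℤ.+ c ℤ.* m ℤ.* q ≡ y ℤ.+ m ℤ.* (c ℤ.* q)
  lem = solve-∀

coprime-* : ∀ {m n k} → Coprime m k → Coprime n k → Coprime (m ℕ.* n) k
coprime-* {m} c c′ {d} (d∣mn , d∣k) = c′ (Coprimality.coprime-divisor d⊥m d∣mn , d∣k)
  where
  d⊥m : Coprime d m
  d⊥m (e∣d , e∣m) = c (e∣m , ℕD.∣-trans e∣d d∣k)

coprime-^ : ∀ {m k} n → Coprime m k → Coprime m (k ℕ.^ n)
coprime-^ zero    c (_ , d∣1) = ℕD.∣1⇒≡1 d∣1
coprime-^ (suc n) c = Coprimality.sym (coprime-* (Coprimality.sym c) (Coprimality.sym (coprime-^ n c)))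

^-coprime : ∀ {m k} n → Coprime m k → Coprime (m ℕ.^ n) k
^-coprime n c = Coprimality.sym (coprime-^ n (Coprimality.sym c))

coprime-prod : ∀ {k} n f → (∀ i → i ℕ.< n → Coprime ∣ f i ∣ k) → Coprime ∣ Z.prod n f ∣ k
coprime-prod         zero    f c = Coprimality.1-coprimeTo _
coprime-prod {k = k} (suc n) f c = subst (λ m → Coprime m k) (≡.sym (ℤP.abs-* (f 0) _))
  (coprime-* (c 0 (s≤s z≤n)) (coprime-prod n (f ∘ suc) λ i i<n → c (suc i) (s≤s i<n)))

mod-cancel : ∀ {x y M} c → Coprime ∣ c ∣ M → c ℤ.* x ≡ c ℤ.* y [ + M ] → x ≡ y [ + M ]
mod-cancel {x} {y} {M} c c⊥M e = ∣⇒mod (Signed.∣ᵤ⇒∣ (Coprimality.coprime-divisor (Coprimality.sym c⊥M)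
  (subst (M ℕD.∣_) (ℤP.abs-* c (x - y)) (Signed.∣⇒∣ᵤ (subst (+ M Signed.∣_) (lem c x y) (mod⇒∣ e))))))
  where
  lem : ∀ c x y → c ℤ.* x - c ℤ.* y ≡ c ℤ.* (x - y)
  lem = solve-∀

prod-! : ∀ n → Z.prod n (λ k → + suc k) ≡ + (n !)
prod-! zero    = ≡.refl
prod-! (suc n) = ≡.trans (Z.Π.snoc n (λ k → + suc k)) (≡.trans (cong (ℤ._* + suc n) (prod-! n))
  (≡.trans (ℤP.*-comm (+ (n !)) (+ suc n)) (≡.sym (ℤP.pos-* (suc n) (n !)))))

prod-!-reverse : ∀ n → Z.prod n (λ k → + (n ℕ.∸ k)) ≡ + (n !)
prod-!-reverse zero    = ≡.refl
prod-!-reverse (suc n) = ≡.trans (cong (+ suc n ℤ.*_) (prod-!-reverse n)) (≡.sym (ℤP.pos-* (suc n) (n !)))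

pos-^ : ∀ a n → + (a ℕ.^ n) ≡ Z.pow n (+ a)
pos-^ a zero    = ≡.refl
pos-^ a (suc n) = ≡.trans (ℤP.pos-* a (a ℕ.^ n)) (cong (+ a ℤ.*_) (pos-^ a n))

geometric : ∀ a n → (a - + 1) ℤ.* Z.sum n (λ k → Z.pow k a) ≡ Z.pow n a - + 1
geometric a zero    = ℤP.*-zeroʳ (a - + 1)
geometric a (suc n) = ≡.trans
  (cong (λ s → (a - + 1) ℤ.* (+ 1 ℤ.+ s)) (≡.sym (Z.*-sum a n (λ k → Z.pow k a))))
  (linear-combination {(a - + 1) ℤ.* Z.sum n (λ k → Z.pow k a)} a (geometric a n)
    (lem a (Z.sum n (λ k → Z.pow k a)) (Z.pow n a)))
  where
  lem : ∀ a s x → (a - + 1) ℤ.* (+ 1 ℤ.+ a ℤ.* s) - (a ℤ.* x - + 1) ≡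
    a ℤ.* ((a - + 1) ℤ.* s - (x - + 1))
  lem = solve-∀

sum-const : ∀ n → Z.sum n (const (+ 1)) ≡ + n
sum-const zero    = ≡.refl
sum-const (suc n) = cong (λ z → + 1 ℤ.+ z) (sum-const n)

linear-W : ∀ c → Linear c (- c) S.≈ K c ⋆ W
linear-W c k = ≡.trans (go k) (≡.sym (PSℤ.K-⋆ c W k))
  where
  lem : ∀ c → - c ≡ c ℤ.* - + 1
  lem = solve-∀
  go : ∀ k → Linear c (- c) k ≡ c ℤ.* W k
  go zero          = ≡.sym (ℤP.*-identityʳ c)
  go (suc zero)    = lem c
  go (suc (suc k)) = ≡.sym (ℤP.*-zeroʳ c)

pow-double : ∀ n x → Z.pow (2 ℕ.* n) x ≡ Z.pow n (x ℤ.* x)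
pow-double n x = ≡.trans (cong (λ m → Z.pow (n ℕ.+ m) x) (ℕP.+-identityʳ n))
  (≡.trans (Z.Π.concat n n (const x)) (≡.sym (Z.Π.zip n (const x) (const x))))

pow-1 : ∀ n → Z.pow n (+ 1) ≡ + 1
pow-1 zero    = ≡.refl
pow-1 (suc n) = ≡.trans (ℤP.*-identityˡ (Z.pow n (+ 1))) (pow-1 n)

sign-square : ∀ n → Z.pow n (- + 1) ℤ.* Z.pow n (- + 1) ≡ + 1
sign-square n = ≡.trans (≡.sym (Z.Π.zip n (const (- + 1)) (const (- + 1)))) (pow-1 n)

pos-∸ : ∀ {m n} → n ℕ.≤ m → + (m ℕ.∸ n) ≡ + m - + n
pos-∸ {m} {n} n≤m = ≡.sym (≡.trans (ℤP.m-n≡m⊖n m n) (ℤP.⊖-≥ n≤m))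

prod-negative : ∀ n → Z.prod n (λ l → + l - + n) ≡ Z.pow n (- + 1) ℤ.* + (n !)
prod-negative n = begin
  Z.prod n (λ l → + l - + n)
    ≡⟨ Z.Π.cong-< n (λ l l<n → ≡.trans (lem (+ l) (+ n)) (cong (- + 1 ℤ.*_) (≡.sym (pos-∸ (ℕP.<⇒≤ l<n))))) ⟩
  Z.prod n (λ l → - + 1 ℤ.* + (n ℕ.∸ l))
    ≡⟨ Z.prod-scale n (- + 1) (λ l → + (n ℕ.∸ l)) ⟩
  Z.pow n (- + 1) ℤ.* Z.prod n (λ l → + (n ℕ.∸ l))
    ≡⟨ cong (Z.pow n (- + 1) ℤ.*_) (prod-!-reverse n) ⟩
  Z.pow n (- + 1) ℤ.* + (n !) ∎
  where
  open ≡.≡-Reasoning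
  lem : ∀ l n → l - n ≡ - + 1 ℤ.* (n - l)
  lem = solve-∀

-- The number v as a coefficient, and its factors divisible by p

v-coeff : ∀ K D → suc K ℕ.+ suc K ≡ suc D →
  v (suc (suc K)) ≡ (W ⋆ S.prod (suc D) (λ j → Linear (+ (D ℕ.∸ j)) (+ j))) (suc K)
v-coeff K D e = begin
  v (suc (suc K))
    ≡⟨ cong (λ m → coeff (suc K) (lin (+ 1) (- (+ 1)) ⊛ prodP (map′ m))) m≡ ⟩
  coeff (suc K) (lin (+ 1) (- (+ 1)) ⊛ prodP (map′ (suc D)))
    ≡⟨ coeffs-⊛ (lin (+ 1) (- (+ 1))) (prodP (map′ (suc D))) (suc K) ⟩
  (coeffs (lin (+ 1) (- (+ 1))) ⋆ coeffs (prodP (map′ (suc D)))) (suc K)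
    ≡⟨ PSℤ.⋆-cong (coeffs-lin (+ 1) (- (+ 1))) (coeffs-prod (factor (suc D)) (suc D)) (suc K) ⟩
  (W ⋆ S.prod (suc D) (coeffs ∘ factor (suc D))) (suc K)
    ≡⟨ PSℤ.⋆-cong {W} (λ _ → ≡.refl) (S.Π.cong-≈ (suc D) λ j → coeffs-lin (+ (D ℕ.∸ j)) (+ j)) (suc K) ⟩
  (W ⋆ S.prod (suc D) (λ j → Linear (+ (D ℕ.∸ j)) (+ j))) (suc K) ∎
  where
  open ≡.≡-Reasoning
  factor : ℕ → ℕ → Poly
  factor m j = lin (+ (m ℕ.∸ 1 ℕ.∸ j)) (+ j)
  map′ : ℕ → _
  map′ m = map (factor m) (upTo m)
  double : ∀ n → 2 ℕ.* n ≡ n ℕ.+ n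
  double n = cong (n ℕ.+_) (ℕP.+-identityʳ n)
  -- The index of `v` is n = K + 2, so the 2n - 2 factors of the definition are D + 1 in number.
  m≡ : 2 ℕ.* suc (suc K) ℕ.∸ 2 ≡ suc D
  m≡ = ≡.trans (cong (ℕ._∸ 2) (≡.trans (double (suc (suc K))) (cong (λ n → suc (suc n)) (ℕP.+-suc K (suc K))))) e

b-coeff : ∀ r j → b j r ≡ S.prod (2 ℕ.* r) (λ i → Linear (+ (2 ℕ.* r ℕ.∸ i)) (+ suc i)) j
b-coeff r j = ≡.trans (coeffs-prod _ (2 ℕ.* r) j)
  (S.Π.cong-≈ (2 ℕ.* r) (λ i → coeffs-lin (+ (2 ℕ.* r ℕ.∸ i)) (+ suc i)) j)

prod-linear-degree : ∀ n (f g : ℕ → ℤ) j → n ℕ.< j → S.prod n (λ i → Linear (f i) (g i)) j ≡ + 0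
prod-linear-degree zero    f g (suc j) n<j       = ≡.refl
prod-linear-degree (suc n) f g (suc j) (s≤s n<j) = ≡.trans
  (PSℤ.linear-⋆ (f 0) (g 0) G j)
  (cong₂ ℤ._+_ (vanish (f 0) (prod-linear-degree n (f ∘ suc) (g ∘ suc) (suc j) (ℕP.m<n⇒m<1+n n<j)))
               (vanish (g 0) (prod-linear-degree n (f ∘ suc) (g ∘ suc) j n<j)))
  where
  G : ℕ → ℤ
  G = S.prod n (λ i → Linear (f (suc i)) (g (suc i)))
  vanish : ∀ c {x} → x ≡ + 0 → c ℤ.* x ≡ + 0
  vanish c ≡.refl = ℤP.*-zeroʳ c

-- The product of the factors of v whose index is prime to p.
units : ℕ → ℕ → ℕ → ℤ
units a q = S.prod a λ i → S.prod q λ k →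
  Linear (+ (a ℕ.* suc q ℕ.∸ suc (i ℕ.* suc q ℕ.+ k))) (+ suc (i ℕ.* suc q ℕ.+ k))

S-reflexive : ∀ {f g : ℕ → ℤ} → f ≡ g → ∀ k → f k ≡ g k
S-reflexive ≡.refl k = ≡.refl

linear-multiple : ∀ c a b → Linear (c ℤ.* a) (c ℤ.* b) S.≈ K c ⋆ Linear a b
linear-multiple c a b k = ≡.trans (go k) (≡.sym (PSℤ.K-⋆ c (Linear a b) k))
  where
  go : ∀ k → Linear (c ℤ.* a) (c ℤ.* b) k ≡ c ℤ.* Linear a b k
  go zero          = ≡.refl
  go (suc zero)    = ≡.refl
  go (suc (suc k)) = ≡.sym (ℤP.*-zeroʳ c)

linear-K : ∀ c → Linear c (+ 0) S.≈ K c
linear-K c zero          = ≡.refl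
linear-K c (suc zero)    = ≡.refl
linear-K c (suc (suc k)) = ≡.refl

linear-X : ∀ c → Linear (+ 0) c S.≈ K c ⋆ X
linear-X c k = ≡.trans (go k) (≡.sym (PSℤ.K-⋆ c X k))
  where
  go : ∀ k → Linear (+ 0) c k ≡ c ℤ.* X k
  go zero          = ≡.sym (ℤP.*-zeroʳ c)
  go (suc zero)    = ≡.sym (ℤP.*-identityʳ c)
  go (suc (suc k)) = ≡.sym (ℤP.*-zeroʳ c)

-- With a = 2r + 1 and D = a p, the factor of index 0 is the constant a p. The index (i + 1) p gives
-- p (2r - i + (i + 1) x), and for i = 2r this is p a x. So two factors a and 2r + 2 factors p come
-- out, together with one x, which lowers the coefficient index from K + 1 to K; the other multiples
-- of p form the polynomial of the `b j r`.
v-factor : ∀ q r K → suc K ℕ.+ suc K ≡ suc (suc (2 ℕ.* r) ℕ.* suc q) →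
  v (suc (suc K)) ≡
    + suc (2 ℕ.* r) ℤ.* + suc (2 ℕ.* r) ℤ.* (+ suc q ℤ.* Z.pow (suc (2 ℕ.* r)) (+ suc q)) ℤ.*
    ((λ j → b j r) ⋆ (W ⋆ units (suc (2 ℕ.* r)) q)) K
v-factor q r k e = begin
  v (suc (suc k))
    ≡⟨ v-coeff k D e ⟩
  (W ⋆ S.prod (suc D) F) (suc k)
    ≡⟨ PSℤ.⋆-cong {W} (λ _ → ≡.refl) all-factors (suc k) ⟩
  (W ⋆ (K A ⋆ K P ⋆ (U ⋆ (S.pow a (K P) ⋆ (B ⋆ (K A ⋆ X)))))) (suc k)
    ≡⟨ S.rearrange W (K A) (K P) U B X (S.pow a (K P)) (suc k) ⟩
  (K A ⋆ K A ⋆ (K P ⋆ S.pow a (K P)) ⋆ (X ⋆ (B ⋆ (W ⋆ U)))) (suc k)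
    ≡⟨ PSℤ.⋆-cong constants (λ _ → ≡.refl) (suc k) ⟩
  (K (A ℤ.* A ℤ.* (P ℤ.* Z.pow a P)) ⋆ (X ⋆ (B ⋆ (W ⋆ U)))) (suc k)
    ≡⟨ PSℤ.K-⋆ (A ℤ.* A ℤ.* (P ℤ.* Z.pow a P)) (X ⋆ (B ⋆ (W ⋆ U))) (suc k) ⟩
  A ℤ.* A ℤ.* (P ℤ.* Z.pow a P) ℤ.* (X ⋆ (B ⋆ (W ⋆ U))) (suc k)
    ≡⟨ cong (A ℤ.* A ℤ.* (P ℤ.* Z.pow a P) ℤ.*_) (≡.trans (PSℤ.linear-⋆ (+ 0) (+ 1) (B ⋆ (W ⋆ U)) k)
         (lem ((B ⋆ (W ⋆ U)) (suc k)) ((B ⋆ (W ⋆ U)) k))) ⟩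
  A ℤ.* A ℤ.* (P ℤ.* Z.pow a P) ℤ.* (B ⋆ (W ⋆ U)) k
    ≡⟨ cong (A ℤ.* A ℤ.* (P ℤ.* Z.pow a P) ℤ.*_)
         (PSℤ.⋆-cong (λ j → ≡.sym (b-coeff r j)) (λ _ → ≡.refl) k) ⟩
  A ℤ.* A ℤ.* (P ℤ.* Z.pow a P) ℤ.* ((λ j → b j r) ⋆ (W ⋆ U)) k ∎
  where
  open ≡.≡-Reasoning
  p a D : ℕ
  p = suc q
  a = suc (2 ℕ.* r)
  D = a ℕ.* p
  A P : ℤ
  A = + a
  P = + p
  F L : ℕ → ℕ → ℤ
  F j = Linear (+ (D ℕ.∸ j)) (+ j)
  L i = Linear (+ (2 ℕ.* r ℕ.∸ i)) (+ suc i)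
  U B : ℕ → ℤ
  U = units a q
  B = S.prod (2 ℕ.* r) L
  lem : ∀ x y → + 0 ℤ.* x ℤ.+ + 1 ℤ.* y ≡ y
  lem = solve-∀
  constants : K A ⋆ K A ⋆ (K P ⋆ S.pow a (K P)) S.≈ K (A ℤ.* A ℤ.* (P ℤ.* Z.pow a P))
  constants = S.sym (S.trans (PSℤ.K-* (A ℤ.* A) (P ℤ.* Z.pow a P)) (PSℤ.⋆-cong (PSℤ.K-* A A)
    (S.trans (PSℤ.K-* P (Z.pow a P)) (PSℤ.⋆-cong {K P} (λ _ → ≡.refl) (PSℤ.K-prod a (const P))))))
  first : F 0 S.≈ K A ⋆ K P
  first = S.trans (linear-K (+ D)) (S.trans (S-reflexive (cong K (ℤP.pos-* a p))) (PSℤ.K-* A P))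
  multiple : ∀ i → F (suc (i ℕ.* p ℕ.+ q)) S.≈ K P ⋆ L i
  multiple i = S.trans (S-reflexive (cong₂ Linear
      (≡.trans (cong +_ D∸) (ℤP.pos-* p (2 ℕ.* r ℕ.∸ i))) (≡.trans (cong +_ index) (ℤP.pos-* p (suc i)))))
    (linear-multiple P (+ (2 ℕ.* r ℕ.∸ i)) (+ suc i))
    where
    index : suc (i ℕ.* p ℕ.+ q) ≡ p ℕ.* suc i
    index = ≡.trans (cong suc (ℕP.+-comm (i ℕ.* p) q)) (ℕP.*-comm (suc i) p)
    D∸ : D ℕ.∸ suc (i ℕ.* p ℕ.+ q) ≡ p ℕ.* (2 ℕ.* r ℕ.∸ i)
    D∸ = ≡.trans (cong₂ ℕ._∸_ (ℕP.*-comm a p) index) (≡.sym (ℕP.*-distribˡ-∸ p a (suc i)))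
  last : L (2 ℕ.* r) S.≈ K A ⋆ X
  last = S.trans (S-reflexive (cong (λ n → Linear (+ n) A) (ℕP.n∸n≡0 (2 ℕ.* r)))) (linear-X A)
  all-multiples : S.prod a (λ i → F (suc (i ℕ.* p ℕ.+ q))) S.≈ S.pow a (K P) ⋆ (B ⋆ (K A ⋆ X))
  all-multiples = S.trans (S.Π.cong-≈ a multiple) (S.trans (S.prod-scale a (K P) L)
    (PSℤ.⋆-cong {S.pow a (K P)} (λ _ → ≡.refl) (S.trans (S.Π.snoc (2 ℕ.* r) L)
      (PSℤ.⋆-cong {B} (λ _ → ≡.refl) last))))
  -- Without index 0 the remaining indices 1, ..., D form a blocks of length p, and each block ends
  -- with its only multiple of p.
  all-factors : S.prod (suc D) F S.≈ K A ⋆ K P ⋆ (U ⋆ (S.pow a (K P) ⋆ (B ⋆ (K A ⋆ X))))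
  all-factors = PSℤ.⋆-cong first
    (S.trans (S.Π.blocks a p (F ∘ suc))
    (S.trans (S.Π.cong-≈ a (λ i → S.Π.snoc q (λ k → F (suc (i ℕ.* p ℕ.+ k)))))
    (S.trans (S.Π.zip a (λ i → S.prod q (λ k → F (suc (i ℕ.* p ℕ.+ k)))) (λ i → F (suc (i ℕ.* p ℕ.+ q))))
      (PSℤ.⋆-cong {U} (λ _ → ≡.refl) all-multiples))))

linear-prod-0 : ∀ n f → S.prod n (λ i → Linear (f i) (+ 1)) 0 ≡ Z.prod n f
linear-prod-0 zero    f = ≡.refl
linear-prod-0 (suc n) f = cong (f 0 ℤ.*_) (linear-prod-0 n (f ∘ suc))

-- Exhibits `omitted` as a coefficient of a product, so that the reindexing lemmas `doubling` and
-- `pairing` for products apply to it.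
linear-prod-1 : ∀ n f → S.prod n (λ i → Linear (f i) (+ 1)) 1 ≡ Z.omitted n f
linear-prod-1 zero    f = ≡.refl
linear-prod-1 (suc n) f = cong₂ ℤ._+_ (cong (f 0 ℤ.*_) (linear-prod-1 n (f ∘ suc)))
  (≡.trans (ℤP.*-identityˡ (S.prod n (λ i → Linear (f (suc i)) (+ 1)) 0)) (linear-prod-0 n (f ∘ suc)))

binom-falling : ∀ n k → + (k !) ℤ.* binom n k ≡ Z.prod k (λ l → + l - + n)
binom-falling n zero    = cong (+ 1 ℤ.*_) (binom-zero n)
binom-falling n (suc k) = begin
  + (suc k !) ℤ.* binom n (suc k)           ≡⟨ cong (ℤ._* binom n (suc k)) (ℤP.pos-* (suc k) (k !)) ⟩
  + suc k ℤ.* + (k !) ℤ.* binom n (suc k)   ≡⟨ swap (+ suc k) (+ (k !)) _ ⟩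
  + (k !) ℤ.* (+ suc k ℤ.* binom n (suc k)) ≡⟨ cong (+ (k !) ℤ.*_) (binom-absorb n k) ⟩
  + (k !) ℤ.* ((+ k - + n) ℤ.* binom n k)   ≡⟨ swap′ (+ (k !)) (+ k - + n) _ ⟩
  + (k !) ℤ.* binom n k ℤ.* (+ k - + n)     ≡⟨ cong (ℤ._* (+ k - + n)) (binom-falling n k) ⟩
  Z.prod k (λ l → + l - + n) ℤ.* (+ k - + n) ≡⟨ ≡.sym (Z.Π.snoc k (λ l → + l - + n)) ⟩
  Z.prod (suc k) (λ l → + l - + n) ∎
  where
  open ≡.≡-Reasoning
  swap : ∀ x y z → x ℤ.* y ℤ.* z ≡ y ℤ.* (x ℤ.* z)
  swap = solve-∀
  swap′ : ∀ x y z → x ℤ.* (y ℤ.* z) ≡ x ℤ.* z ℤ.* y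
  swap′ = solve-∀

abs-negative : ∀ {i n} → i ℕ.≤ n → ∣ + i - + n ∣ ≡ n ℕ.∸ i
abs-negative {i} {n} i≤n = ≡.trans (cong ∣_∣ (ℤP.m-n≡m⊖n i n)) (ℤP.∣⊖∣-≤ i≤n)

-- Arithmetic modulo an odd prime

module OddPrime (g : ℕ) (prime : Prime (suc (suc g ℕ.+ suc g))) where

  -- Taking h as a successor gives the exponent h - 1 of `prod-linear` the name `g`.
  h q p : ℕ
  h = suc g
  q = h ℕ.+ h
  p = suc q

  module P = Ring (ℤmod (+ p))

  coprime-< : ∀ n → n ℕ.< q → Coprime (suc n) p
  coprime-< n n<q = Coprimality.sym (Coprimality.prime⇒coprime prime (s≤s n<q))

  coprime-! : ∀ n → n ℕ.≤ q → Coprime (n !) p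
  coprime-! zero    n≤q = Coprimality.1-coprimeTo p
  coprime-! (suc n) n≤q = coprime-* (coprime-< n n≤q) (coprime-! n (ℕP.<⇒≤ n≤q))

  coprime-2 : Coprime 2 p
  coprime-2 = coprime-< 1 (s≤s (subst (1 ℕ.≤_) (≡.sym (ℕP.+-suc g g)) (s≤s z≤n)))

  p≡0 : + p P.≈ + 0
  p≡0 = mod (+ 1) (lem (+ p))
    where
    lem : ∀ p → p ≡ + 0 ℤ.+ p ℤ.* + 1
    lem = solve-∀

  -- The row q + a p is -1 modulo p. At an index k ≡ t, `binom-absorb` therefore has the factor t +
  -- 1 on both sides, and it is invertible as long as t < q.
  binom-block : ∀ a i t → t ℕ.≤ q → binom (q ℕ.+ a ℕ.* p) (i ℕ.* p ℕ.+ t) P.≈ binom (q ℕ.+ a ℕ.* p) (i ℕ.* p)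
  binom-block a i zero    t≤q = P.reflexive (cong (binom (q ℕ.+ a ℕ.* p)) (ℕP.+-identityʳ (i ℕ.* p)))
  binom-block a i (suc t) t<q = P.trans
    (mod-cancel (+ suc t) (coprime-< t t<q) step)
    (binom-block a i t (ℕP.<⇒≤ t<q))
    where
    n k : ℕ
    n = q ℕ.+ a ℕ.* p
    k = i ℕ.* p ℕ.+ t
    lem : ∀ q a i t x y →
      (+ 1 ℤ.+ t) ℤ.* y - (+ 1 ℤ.+ t) ℤ.* x ℤ.+ (+ 1 ℤ.+ q) ℤ.* (i ℤ.* y - (i - a - + 1) ℤ.* x) ≡
      (+ 1 ℤ.+ (i ℤ.* (+ 1 ℤ.+ q) ℤ.+ t)) ℤ.* y
        - (i ℤ.* (+ 1 ℤ.+ q) ℤ.+ t - (q ℤ.+ a ℤ.* (+ 1 ℤ.+ q))) ℤ.* x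
    lem = solve-∀
    lem′ : ∀ y x m s → y - (x ℤ.+ m ℤ.* - s) ≡ + 1 ℤ.* (y - x ℤ.+ m ℤ.* s - + 0)
    lem′ = solve-∀
    x y : ℤ
    x = binom n k
    y = binom n (i ℕ.* p ℕ.+ suc t)
    absorb : (+ 1 ℤ.+ (+ i ℤ.* + p ℤ.+ + t)) ℤ.* y - (+ i ℤ.* + p ℤ.+ + t - (+ q ℤ.+ + a ℤ.* + p)) ℤ.* x ≡ + 0
    absorb = ℤP.i≡j⇒i-j≡0 (begin
      (+ 1 ℤ.+ (+ i ℤ.* + p ℤ.+ + t)) ℤ.* y
        ≡⟨ cong₂ (λ u v → (+ 1 ℤ.+ (u ℤ.+ + t)) ℤ.* binom n v) (≡.sym (ℤP.pos-* i p)) (ℕP.+-suc (i ℕ.* p) t) ⟩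
      + suc k ℤ.* binom n (suc k)
        ≡⟨ binom-absorb n k ⟩
      (+ k - + n) ℤ.* x
        ≡⟨ cong₂ (λ u v → (u ℤ.+ + t - (+ q ℤ.+ v)) ℤ.* x) (ℤP.pos-* i p) (ℤP.pos-* a p) ⟩
      (+ i ℤ.* + p ℤ.+ + t - (+ q ℤ.+ + a ℤ.* + p)) ℤ.* x ∎)
      where open ≡.≡-Reasoning
    s : ℤ
    s = + i ℤ.* y - (+ i - + a - + 1) ℤ.* x
    step : + suc t ℤ.* y P.≈ + suc t ℤ.* x
    step = mod (- s)
      (linear-combination {_} {+ 0} (+ 1) (≡.trans (lem (+ q) (+ a) (+ i) (+ t) x y) absorb)
        (lem′ (+ suc t ℤ.* y) (+ suc t ℤ.* x) (+ p) s))

  -- Crossing a block boundary: in `binom-absorb` both factors, (i + 1) p and (i - a) p, are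
  -- multiples of p. This p is cancelled over the integers before reducing, and `binom-block` then
  -- moves back to the start of the block.
  binom-step : ∀ a i → + suc i ℤ.* binom (q ℕ.+ a ℕ.* p) (suc i ℕ.* p) P.≈
                       (+ i - + a) ℤ.* binom (q ℕ.+ a ℕ.* p) (i ℕ.* p)
  binom-step a i = P.trans (P.reflexive cancelled) (P.*-congˡ {+ i - + a} (binom-block a i q ℕP.≤-refl))
    where
    n k : ℕ
    n = q ℕ.+ a ℕ.* p
    k = i ℕ.* p ℕ.+ q
    x y : ℤ
    x = binom n k
    y = binom n (suc i ℕ.* p)
    lem₁ : ∀ p i y → p ℤ.* ((+ 1 ℤ.+ i) ℤ.* y) ≡ (p ℤ.+ i ℤ.* p) ℤ.* y
    lem₁ = solve-∀
    lem₂ : ∀ p q a i x → (i ℤ.* p ℤ.+ q - (q ℤ.+ a ℤ.* p)) ℤ.* x ≡ p ℤ.* ((i - a) ℤ.* x)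
    lem₂ = solve-∀
    suc-k : suc k ≡ suc i ℕ.* p
    suc-k = cong suc (ℕP.+-comm (i ℕ.* p) q)
    open ≡.≡-Reasoning
    cancelled : + suc i ℤ.* y ≡ (+ i - + a) ℤ.* x
    cancelled = ℤP.*-cancelˡ-≡ (+ p) _ _ (begin
      + p ℤ.* (+ suc i ℤ.* y)
        ≡⟨ lem₁ (+ p) (+ i) y ⟩
      (+ p ℤ.+ + i ℤ.* + p) ℤ.* y
        ≡⟨ cong (λ u → (+ p ℤ.+ u) ℤ.* y) (≡.sym (ℤP.pos-* i p)) ⟩
      + (suc i ℕ.* p) ℤ.* y
        ≡⟨ cong (λ u → + u ℤ.* binom n u) (≡.sym suc-k) ⟩
      + suc k ℤ.* binom n (suc k)
        ≡⟨ binom-absorb n k ⟩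
      (+ k - + n) ℤ.* x
        ≡⟨ cong₂ (λ u v → (u ℤ.+ + q - (+ q ℤ.+ v)) ℤ.* x) (ℤP.pos-* i p) (ℤP.pos-* a p) ⟩
      (+ i ℤ.* + p ℤ.+ + q - (+ q ℤ.+ + a ℤ.* + p)) ℤ.* x
        ≡⟨ lem₂ (+ p) (+ q) (+ a) (+ i) x ⟩
      + p ℤ.* ((+ i - + a) ℤ.* x) ∎)

  -- Lucas's congruence c(q + a p, i p) ≡ c(a, i), kept multiplied by i!; it is `binom-step`
  -- telescoped.
  binom-lucas : ∀ a i → + (i !) ℤ.* binom (q ℕ.+ a ℕ.* p) (i ℕ.* p) P.≈ Z.prod i (λ l → + l - + a)
  binom-lucas a zero    = P.reflexive (cong (+ 1 ℤ.*_) (binom-zero (q ℕ.+ a ℕ.* p)))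
  binom-lucas a (suc i) = P.begin
    + (suc i !) ℤ.* binom n (suc i ℕ.* p)
      P.≡⟨ cong (ℤ._* binom n (suc i ℕ.* p)) (ℤP.pos-* (suc i) (i !)) ⟩
    + suc i ℤ.* + (i !) ℤ.* binom n (suc i ℕ.* p)
      P.≡⟨ swap (+ suc i) (+ (i !)) _ ⟩
    + (i !) ℤ.* (+ suc i ℤ.* binom n (suc i ℕ.* p))
      P.≈⟨ P.*-congˡ {+ (i !)} (binom-step a i) ⟩
    + (i !) ℤ.* ((+ i - + a) ℤ.* binom n (i ℕ.* p))
      P.≡⟨ swap′ (+ (i !)) (+ i - + a) _ ⟩
    + (i !) ℤ.* binom n (i ℕ.* p) ℤ.* (+ i - + a)
      P.≈⟨ P.*-congʳ {+ i - + a} (binom-lucas a i) ⟩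
    Z.prod i (λ l → + l - + a) ℤ.* (+ i - + a)
      P.≡⟨ ≡.sym (Z.Π.snoc i (λ l → + l - + a)) ⟩
    Z.prod (suc i) (λ l → + l - + a) P.∎
    where
    n : ℕ
    n = q ℕ.+ a ℕ.* p
    swap : ∀ x y z → x ℤ.* y ℤ.* z ≡ y ℤ.* (x ℤ.* z)
    swap = solve-∀
    swap′ : ∀ x y z → x ℤ.* (y ℤ.* z) ≡ x ℤ.* z ℤ.* y
    swap′ = solve-∀

  binom-row : ∀ k → k ℕ.≤ q → binom q k P.≈ + 1
  binom-row k k≤q = subst (λ n → binom n k P.≈ + 1) (ℕP.+-identityʳ q)
    (P.trans (binom-block 0 0 k k≤q) (P.reflexive (binom-zero (q ℕ.+ 0))))

  -- Fermat's and Wilson's theorems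

  difference-sum : ∀ f → (S.pow q W ⋆ f) q P.≈ Z.sum p f
  difference-sum f = P.begin
    (S.pow q W ⋆ f) q
      P.≡⟨ PSℤ.⋆-comm (S.pow q W) f q ⟩
    (f ⋆ S.pow q W) q
      P.≡⟨ PSℤ.⋆-sum f (S.pow q W) q ⟩
    Z.sum p (λ j → f j ℤ.* S.pow q W (q ℕ.∸ j))
      P.≈⟨ P.Σ.cong-≈ p (λ j → P.trans (P.*-congˡ {f j} (P.trans (P.reflexive (W-pow q (q ℕ.∸ j)))
             (binom-row (q ℕ.∸ j) (ℕP.m∸n≤m q j)))) (P.*-identityʳ (f j))) ⟩
    Z.sum p f P.∎

  -- The q-th difference of the sequence a^i is evaluated twice: exactly as (a - 1)^q, and by
  -- `difference-sum` as a geometric sum that the factor a - 1 telescopes.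
  freshman : ∀ a → Z.pow p (a - + 1) P.≈ Z.pow p a - + 1
  freshman a = P.begin
    (a - + 1) ℤ.* Z.pow q (a - + 1)
      P.≡⟨ cong ((a - + 1) ℤ.*_) (≡.sym (ℤP.*-identityʳ (Z.pow q (a - + 1)))) ⟩
    (a - + 1) ℤ.* (Z.pow q (a - + 1) ℤ.* + 1)
      P.≡⟨ cong ((a - + 1) ℤ.*_) (≡.sym (difference-geometric a q 0)) ⟩
    (a - + 1) ℤ.* (S.pow q W ⋆ λ i → Z.pow i a) (q ℕ.+ 0)
      P.≡⟨ cong (λ n → (a - + 1) ℤ.* (S.pow q W ⋆ λ i → Z.pow i a) n) (ℕP.+-identityʳ q) ⟩
    (a - + 1) ℤ.* (S.pow q W ⋆ λ i → Z.pow i a) q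
      P.≈⟨ P.*-congˡ {a - + 1} (difference-sum (λ i → Z.pow i a)) ⟩
    (a - + 1) ℤ.* Z.sum p (λ i → Z.pow i a)
      P.≡⟨ geometric a p ⟩
    Z.pow p a - + 1 P.∎

  fermat : ∀ a → Z.pow p (+ a) P.≈ + a
  fermat zero    = P.reflexive (ℤP.*-zeroˡ (Z.pow q (+ 0)))
  fermat (suc a) = P.begin
    Z.pow p (+ suc a)                 P.≡⟨ lem (Z.pow p (+ suc a)) ⟩
    + 1 ℤ.+ (Z.pow p (+ suc a) - + 1) P.≈⟨ P.+-congˡ {+ 1} (P.sym (freshman (+ suc a))) ⟩
    + 1 ℤ.+ Z.pow p (+ a)             P.≈⟨ P.+-congˡ {+ 1} (fermat a) ⟩
    + suc a P.∎
    where
    lem : ∀ x → x ≡ + 1 ℤ.+ (x - + 1)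
    lem = solve-∀

  fermat′ : ∀ a → Coprime a p → Z.pow q (+ a) P.≈ + 1
  fermat′ a a⊥p = mod-cancel (+ a) a⊥p (P.trans (fermat a) (P.reflexive (≡.sym (ℤP.*-identityʳ (+ a)))))

  -- The q-th difference of i^q is q! exactly; by `difference-sum` it is also the sum of i^q over
  -- all residues, which Fermat evaluates to q ≡ -1.
  wilson : + (q !) P.≈ - + 1
  wilson = P.begin
    + (q !)
      P.≡⟨ ≡.sym (difference-power q 0) ⟩
    (S.pow q W ⋆ λ i → Z.pow q (+ i)) (q ℕ.+ 0)
      P.≡⟨ cong (S.pow q W ⋆ λ i → Z.pow q (+ i)) (ℕP.+-identityʳ q) ⟩
    (S.pow q W ⋆ λ i → Z.pow q (+ i)) q
      P.≈⟨ difference-sum (λ i → Z.pow q (+ i)) ⟩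
    Z.pow q (+ 0) ℤ.+ Z.sum q (λ i → Z.pow q (+ suc i))
      P.≈⟨ P.+-cong (P.reflexive (ℤP.*-zeroˡ (Z.pow (g ℕ.+ h) (+ 0))))
                    (P.Σ.cong-< q λ i i<q → fermat′ (suc i) (coprime-< i i<q)) ⟩
    + 0 ℤ.+ Z.sum q (const (+ 1))
      P.≡⟨ ≡.trans (ℤP.+-identityˡ _) (sum-const q) ⟩
    + q
      P.≡⟨ lem (+ q) ⟩
    - + 1 ℤ.+ + p ℤ.* + 1
      P.≈⟨ P.+-congˡ { - + 1} (P.*-congʳ {+ 1} p≡0) ⟩
    - + 1 P.∎
    where
    lem : ∀ q → q ≡ - + 1 ℤ.+ (+ 1 ℤ.+ q) ℤ.* + 1
    lem = solve-∀

  -- Sums of inverse squares modulo p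

  p⁺ : ℤ
  p⁺ = + p

  module Sp = Ring (PowerSeries.powerSeries (ℤmod p⁺))
  module PSp = PowerSeries (ℤmod p⁺)

  coprime-∸ : ∀ i n → n ℕ.≤ q → i ℕ.< n → Coprime ∣ + i - + n ∣ p
  coprime-∸ i n n≤q i<n = subst (λ m → Coprime m p)
    (≡.trans (≡.sym (ℕP.+-∸-assoc 1 i<n)) (≡.sym (abs-negative (ℕP.<⇒≤ i<n))))
    (coprime-< (n ℕ.∸ suc i) (ℕP.<-≤-trans (ℕP.∸-monoʳ-< (s≤s z≤n) i<n) n≤q))

  h≤q : h ℕ.≤ q
  h≤q = ℕP.m≤m+n h h

  square : ℕ → ℤ
  square k = + suc k ℤ.* + suc k

  coprime-squares : Coprime ∣ Z.prod h square ∣ p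
  coprime-squares = coprime-prod h square λ i i<h → subst (λ m → Coprime m p)
    (≡.sym (ℤP.abs-* (+ suc i) (+ suc i)))
    (coprime-* (coprime-< i (ℕP.<-≤-trans i<h h≤q)) (coprime-< i (ℕP.<-≤-trans i<h h≤q)))

  suc-∸ : ∀ {k} → k ℕ.< q → suc (q ℕ.∸ suc k) ≡ q ℕ.∸ k
  suc-∸ k<q = ≡.sym (ℕP.+-∸-assoc 1 k<q)

  ∸≡-suc : ∀ {k} → k ℕ.≤ q → + (q ℕ.∸ k) ≡ p⁺ - + suc k
  ∸≡-suc k≤q = pos-∸ (s≤s k≤q)

  ∸≡- : ∀ {k} → k ℕ.≤ q → + (q ℕ.∸ k) P.≈ - + suc k
  ∸≡- {k} k≤q = P.trans (P.reflexive (≡.trans (∸≡-suc k≤q) (lem p⁺ (+ suc k))))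
    (mod (+ 1) ≡.refl)
    where
    lem : ∀ p k → p - k ≡ - k ℤ.+ p ℤ.* + 1
    lem = solve-∀

  fermat-square : Coprime 2 p → Z.pow q (+ 4) P.≈ + 1
  fermat-square c = fermat′ 4 (coprime-* {2} {2} c c)

  -- Doubling permutes the squares modulo p up to the factor 4, so that e = omitted q square
  -- satisfies 4 e ≡ e.
  omitted-squares-full : Coprime 3 p → Z.omitted q square P.≈ + 0
  omitted-squares-full 3⊥p = mod-cancel (+ 3) 3⊥p (P.begin
    + 3 ℤ.* e             P.≡⟨ lem₁ e ⟩
    + 4 ℤ.* e - e         P.≈⟨ P.+-congʳ { - e} (P.*-congˡ {+ 4} (P.sym doubled)) ⟩
    + 4 ℤ.* e′ - e        P.≡⟨ cong (_- e) (Z.omitted-scale q (+ 4) square) ⟩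
    Z.pow q (+ 4) ℤ.* e - e P.≈⟨ P.+-congʳ { - e} (P.*-congʳ {e} (fermat-square coprime-2)) ⟩
    + 1 ℤ.* e - e         P.≡⟨ lem₂ e ⟩
    + 3 ℤ.* + 0 P.∎)
    where
    e e′ : ℤ
    e = Z.omitted q square
    e′ = Z.omitted q (λ k → + 4 ℤ.* square k)
    lem₁ : ∀ e → + 3 ℤ.* e ≡ + 4 ℤ.* e - e
    lem₁ = solve-∀
    lem₂ : ∀ e → + 1 ℤ.* e - e ≡ + 0
    lem₂ = solve-∀
    lem₃ : ∀ k → (k ℤ.+ k) ℤ.* (k ℤ.+ k) ≡ + 4 ℤ.* (k ℤ.* k)
    lem₃ = solve-∀
    lem₄ : ∀ p i → (p ℤ.+ i) ℤ.* (p ℤ.+ i) ≡ i ℤ.* i ℤ.+ p ℤ.* (p ℤ.+ + 2 ℤ.* i)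
    lem₄ = solve-∀
    -- The series j² + x depends on j only modulo p, so `doubling` permutes the product of these
    -- series; the coefficient of x gives the claim about `omitted`.
    f : ℕ → ℕ → ℤ
    f j = Linear (+ j ℤ.* + j) (+ 1)
    periodic : ∀ i → f (p ℕ.+ i) Sp.≈ f i
    periodic i = PSp.linear-cong (mod (p⁺ ℤ.+ + 2 ℤ.* + i) (lem₄ p⁺ (+ i))) P.refl
    doubled : e′ P.≈ e
    doubled = P.trans (P.reflexive (≡.trans (Z.omitted-cong q λ k _ → ≡.sym (lem₃ (+ suc k)))
        (≡.sym (linear-prod-1 q (λ k → + (suc k ℕ.+ suc k) ℤ.* + (suc k ℕ.+ suc k))))))
      (P.trans (Sp.Π.doubling h f periodic 1) (P.reflexive (linear-prod-1 q square)))

  -- Since k and p - k have the same square, ∏ (k² + x) over all nonzero residues is F² for the half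
  -- product F. Its coefficient of x is 2 F(0) F(1), and 2 and F(0) are invertible.
  omitted-squares : Coprime 3 p → Z.omitted h square P.≈ + 0
  omitted-squares 3⊥p = mod-cancel (Z.prod h square) coprime-squares (mod-cancel (+ 2) coprime-2 (P.begin
    + 2 ℤ.* (Z.prod h square ℤ.* Z.omitted h square)
      P.≡⟨ cong₂ (λ x y → + 2 ℤ.* (x ℤ.* y)) (≡.sym (linear-prod-0 h square)) (≡.sym (linear-prod-1 h square)) ⟩
    + 2 ℤ.* (F 0 ℤ.* F 1)
      P.≡⟨ lem (F 0) (F 1) ⟩
    (F ⋆ F) 1
      P.≈⟨ P.sym (halves 1) ⟩
    S.prod q G 1
      P.≡⟨ linear-prod-1 q square ⟩
    Z.omitted q square
      P.≈⟨ omitted-squares-full 3⊥p ⟩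
    + 0
      P.≡⟨ ≡.sym (cong (+ 2 ℤ.*_) (ℤP.*-zeroʳ (Z.prod h square))) ⟩
    + 2 ℤ.* (Z.prod h square ℤ.* + 0) P.∎))
    where
    G : ℕ → ℕ → ℤ
    G k = Linear (square k) (+ 1)
    F : ℕ → ℤ
    F = S.prod h G
    lem : ∀ x y → + 2 ℤ.* (x ℤ.* y) ≡ x ℤ.* y ℤ.+ y ℤ.* x
    lem = solve-∀
    lem₂ : ∀ x → - x ℤ.* - x ≡ x ℤ.* x
    lem₂ = solve-∀
    mirror : ∀ k → k ℕ.< h → square (q ℕ.∸ suc k) P.≈ square k
    mirror k k<h = P.trans (P.reflexive (cong (λ n → + n ℤ.* + n) (suc-∸ k<q)))
      (P.trans (P.*-cong (∸≡- (ℕP.<⇒≤ k<q)) (∸≡- (ℕP.<⇒≤ k<q))) (P.reflexive (lem₂ (+ suc k))))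
      where
      k<q : k ℕ.< q
      k<q = ℕP.<-≤-trans k<h h≤q
    halves : S.prod q G Sp.≈ F ⋆ F
    halves = Sp.trans (Sp.Π.pairing h G) (Sp.trans
      (Sp.Π.cong-< h λ k k<h → PSp.⋆-cong {G k} (λ _ → P.refl) (PSp.linear-cong {b = + 1} (mirror k k<h) P.refl))
      (Sp.Π.zip h G G))

  pair : ℕ → ℤ
  pair k = + (q ℕ.∸ k) ℤ.* + suc k

  -- Modulo p a pair m (p - m) is -m², so this is `omitted-squares` up to a sign; the factor -1 in
  -- front comes from the shape of `omitted-scale`.
  omitted-pairs : Coprime 3 p → Z.omitted h pair P.≈ + 0
  omitted-pairs 3⊥p = mod-cancel (- + 1) (Coprimality.1-coprimeTo p) (P.begin
    - + 1 ℤ.* Z.omitted h pair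
      P.≈⟨ P.*-congˡ { - + 1} (P.omitted-cong h step) ⟩
    - + 1 ℤ.* Z.omitted h (λ k → - + 1 ℤ.* square k)
      P.≡⟨ Z.omitted-scale h (- + 1) square ⟩
    Z.pow h (- + 1) ℤ.* Z.omitted h square
      P.≈⟨ P.*-congˡ {Z.pow h (- + 1)} (omitted-squares 3⊥p) ⟩
    Z.pow h (- + 1) ℤ.* + 0
      P.≡⟨ ℤP.*-zeroʳ (Z.pow h (- + 1)) ⟩
    + 0 P.∎)
    where
    lem : ∀ x → - x ℤ.* x ≡ - + 1 ℤ.* (x ℤ.* x)
    lem = solve-∀
    step : ∀ k → k ℕ.< h → pair k P.≈ - + 1 ℤ.* square k
    step k k<h = P.trans (P.*-congʳ {+ suc k} (∸≡- (ℕP.<⇒≤ (ℕP.<-≤-trans k<h h≤q)))) (P.reflexive (lem (+ suc k)))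

  prod-pairs : Z.prod h pair ≡ + (q !)
  prod-pairs = ≡.sym (≡.trans (≡.sym (prod-! q)) (≡.trans (Z.Π.pairing h (λ k → + suc k))
    (Z.Π.cong-< h λ k k<h → ≡.trans (cong (λ n → + suc k ℤ.* + n) (suc-∸ (ℕP.<-≤-trans k<h h≤q)))
                                    (ℤP.*-comm (+ suc k) (+ (q ℕ.∸ k))))))

  -- The factors prime to p, modulo p³

  module Cubic = Ring (PowerSeries.powerSeries (ℤmod (p⁺ ℤ.* p⁺ ℤ.* p⁺)))
  module PSc = PowerSeries (ℤmod (p⁺ ℤ.* p⁺ ℤ.* p⁺))
  module P³ = Ring (ℤmod (p⁺ ℤ.* p⁺ ℤ.* p⁺))

  vanish : ∀ {c} f → c P³.≈ + 0 → K c ⋆ f Cubic.≈ Cubic.0#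
  vanish {c} f e k = P³.trans (PSc.K-⋆ c f k)
    (P³.trans (P³.*-congʳ {f k} e) (P³.reflexive (ℤP.*-zeroˡ (f k))))

  -- Expansion in u = p² x: u² is a multiple of p⁴, and the linear term is p² times
  -- `omitted h pair`, itself a multiple of p. Only the product of the terms m (p - m) w² remains.
  units-cubic : Coprime 3 p → units 1 q Cubic.≈ K (+ (q !)) ⋆ S.pow q W
  units-cubic 3⊥p = Cubic.begin
    units 1 q
      Cubic.≈⟨ (λ k → P³.reflexive (S.trans (S.*-identityʳ _) (S.Π.cong-≈ q λ k →
                 S-reflexive (cong (λ n → Linear (+ (n ℕ.∸ k)) (+ suc k)) (ℕP.+-identityʳ q))) k)) ⟩
    S.prod q L
      Cubic.≈⟨ Cubic.Π.pairing h L ⟩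
    S.prod h (λ k → L k ⋆ L (q ℕ.∸ suc k))
      Cubic.≈⟨ Cubic.Π.cong-< h (λ k k<h j → P³.reflexive (paired k (ℕP.<-≤-trans k<h h≤q) j)) ⟩
    S.prod h (λ k → K (pair k) ⋆ (W ⋆ W) S.+ u)
      Cubic.≈⟨ Cubic.prod-linear g (K ∘ pair) (W ⋆ W) u u²≈0 ⟩
    S.prod h (K ∘ pair) ⋆ S.pow h (W ⋆ W) S.+ S.omitted h (K ∘ pair) ⋆ S.pow g (W ⋆ W) ⋆ u
      Cubic.≈⟨ Cubic.+-cong {S.prod h (K ∘ pair) ⋆ S.pow h (W ⋆ W)} main rest ⟩
    K (+ (q !)) ⋆ S.pow q W S.+ Cubic.0#
      Cubic.≈⟨ Cubic.+-identityʳ (K (+ (q !)) ⋆ S.pow q W) ⟩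
    K (+ (q !)) ⋆ S.pow q W Cubic.∎
    where
    L : ℕ → ℕ → ℤ
    L k = Linear (+ (q ℕ.∸ k)) (+ suc k)
    u : ℕ → ℤ
    u = K (p⁺ ℤ.* p⁺) ⋆ X
    u²≈0 : u ⋆ u Cubic.≈ Cubic.0#
    u²≈0 = Cubic.begin
      u ⋆ u
        Cubic.≈⟨ Cubic.Π.interchange (K (p⁺ ℤ.* p⁺)) X (K (p⁺ ℤ.* p⁺)) X ⟩
      K (p⁺ ℤ.* p⁺) ⋆ K (p⁺ ℤ.* p⁺) ⋆ (X ⋆ X)
        Cubic.≈⟨ PSc.⋆-cong {g = X ⋆ X} (Cubic.sym (PSc.K-* (p⁺ ℤ.* p⁺) (p⁺ ℤ.* p⁺))) (λ _ → P³.refl) ⟩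
      K (p⁺ ℤ.* p⁺ ℤ.* (p⁺ ℤ.* p⁺)) ⋆ (X ⋆ X)
        Cubic.≈⟨ vanish (X ⋆ X) (mod p⁺ (lem p⁺)) ⟩
      Cubic.0# Cubic.∎
      where
      lem : ∀ p → p ℤ.* p ℤ.* (p ℤ.* p) ≡ + 0 ℤ.+ p ℤ.* p ℤ.* p ℤ.* p
      lem = solve-∀
    paired : ∀ k → k ℕ.< q → L k ⋆ L (q ℕ.∸ suc k) S.≈ K (pair k) ⋆ (W ⋆ W) S.+ u
    paired k k<q = S.trans
      (PSℤ.⋆-cong {L k} (λ _ → ≡.refl) (S-reflexive (cong₂ (λ m n → Linear (+ m) (+ n))
        (ℕP.m∸[m∸n]≡n k<q) (suc-∸ k<q))))
      (S.trans (linear-pair (+ (q ℕ.∸ k)) (+ suc k))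
        (λ j → cong (λ s → (K (pair k) ⋆ (W ⋆ W)) j ℤ.+ (K (s ℤ.* s) ⋆ X) j) total))
      where
      lem : ∀ p x → p - x ℤ.+ x ≡ p
      lem = solve-∀
      total : + (q ℕ.∸ k) ℤ.+ + suc k ≡ p⁺
      total = ≡.trans (cong (ℤ._+ + suc k) (∸≡-suc (ℕP.<⇒≤ k<q))) (lem p⁺ (+ suc k))
    main : S.prod h (K ∘ pair) ⋆ S.pow h (W ⋆ W) Cubic.≈ K (+ (q !)) ⋆ S.pow q W
    main k = P³.reflexive (PSℤ.⋆-cong
      (S.trans (S.sym (PSℤ.K-prod h pair)) (S-reflexive (cong K prod-pairs)))
      (S.trans (S.Π.zip h (const W) (const W)) (S.sym (S.Π.concat h h (const W)))) k)
    rest : S.omitted h (K ∘ pair) ⋆ S.pow g (W ⋆ W) ⋆ u Cubic.≈ Cubic.0#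
    rest = Cubic.begin
      S.omitted h (K ∘ pair) ⋆ Y ⋆ (K (p⁺ ℤ.* p⁺) ⋆ X)
        Cubic.≈⟨ Cubic.Π.interchange (S.omitted h (K ∘ pair)) Y (K (p⁺ ℤ.* p⁺)) X ⟩
      S.omitted h (K ∘ pair) ⋆ K (p⁺ ℤ.* p⁺) ⋆ (Y ⋆ X)
        Cubic.≈⟨ (λ k → P³.reflexive (PSℤ.⋆-cong {g = Y ⋆ X} (S.trans
                   (PSℤ.⋆-cong {g = K (p⁺ ℤ.* p⁺)} (S.sym (PSℤ.K-omitted h pair)) (λ _ → ≡.refl))
                   (S.sym (PSℤ.K-* (Z.omitted h pair) (p⁺ ℤ.* p⁺)))) (λ _ → ≡.refl) k)) ⟩
      K (Z.omitted h pair ℤ.* (p⁺ ℤ.* p⁺)) ⋆ (Y ⋆ X)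
        Cubic.≈⟨ vanish (Y ⋆ X) (multiple (Z.omitted h pair) (omitted-pairs 3⊥p)) ⟩
      Cubic.0# Cubic.∎
      where
      Y : ℕ → ℤ
      Y = S.pow g (W ⋆ W)
      lem : ∀ p x → (+ 0 ℤ.+ p ℤ.* x) ℤ.* (p ℤ.* p) ≡ + 0 ℤ.+ p ℤ.* p ℤ.* p ℤ.* x
      lem = solve-∀
      multiple : ∀ e → e P.≈ + 0 → e ℤ.* (p⁺ ℤ.* p⁺) P³.≈ + 0
      multiple _ (mod x ≡.refl) = mod x (lem p⁺ x)

  -- The middle binomial coefficient and part 1

  module P² = Ring (ℤmod (p⁺ ℤ.* p⁺))

  -- ∏ (2 j - p) and ∏ (j - p) over 1 ≤ j ≤ h are compared by splitting ∏_{l<q} (l + 1 - p) both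
  -- into halves and by parity.
  half-products :
    Z.prod h (λ l → + l - + h) ℤ.* Z.prod h (λ l → + suc l - p⁺) ≡
    Z.prod h (λ l → + l - + h) ℤ.* (Z.pow h (+ 2) ℤ.* Z.prod h (λ l → + suc l ℤ.* + 2 - p⁺))
  half-products = begin
    N ℤ.* Z.prod h f
      ≡⟨ ℤP.*-comm N (Z.prod h f) ⟩
    Z.prod h f ℤ.* N
      -- The upper half has f(h + i) = i - h, and the even-indexed factors have f(2i) = 2 (i - h).
      -- So both splittings contain N, which stays as a common factor until it is cancelled modulo
      -- p².
      ≡⟨ cong (Z.prod h f ℤ.*_) (Z.Π.cong-≈ h λ i → lem₁ (+ h) (+ i)) ⟩
    Z.prod h f ℤ.* Z.prod h (λ i → f (h ℕ.+ i))
      ≡⟨ ≡.sym (Z.Π.concat h h f) ⟩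
    Z.prod q f
      ≡⟨ Z.Π.even-odd h f ⟩
    Z.prod h (λ i → f (i ℕ.+ i)) ℤ.* Z.prod h (λ i → f (suc (i ℕ.+ i)))
      ≡⟨ cong₂ ℤ._*_ (≡.trans (Z.Π.cong-≈ h λ i → lem₂ (+ h) (+ i)) (Z.prod-scale h (+ 2) (λ i → + i - + h)))
                     (Z.Π.cong-≈ h λ i → lem₃ (+ h) (+ i)) ⟩
    Z.pow h (+ 2) ℤ.* N ℤ.* O
      ≡⟨ lem₄ (Z.pow h (+ 2)) N O ⟩
    N ℤ.* (Z.pow h (+ 2) ℤ.* O) ∎
    where
    open ≡.≡-Reasoning
    f : ℕ → ℤ
    f l = + suc l - p⁺
    N O : ℤ
    N = Z.prod h (λ l → + l - + h)
    O = Z.prod h (λ l → + suc l ℤ.* + 2 - p⁺)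
    lem₁ : ∀ h i → i - h ≡ + 1 ℤ.+ (h ℤ.+ i) - (+ 1 ℤ.+ (h ℤ.+ h))
    lem₁ = solve-∀
    lem₂ : ∀ h i → + 1 ℤ.+ (i ℤ.+ i) - (+ 1 ℤ.+ (h ℤ.+ h)) ≡ + 2 ℤ.* (i - h)
    lem₂ = solve-∀
    lem₃ : ∀ h i → + 2 ℤ.+ (i ℤ.+ i) - (+ 1 ℤ.+ (h ℤ.+ h)) ≡ (+ 1 ℤ.+ i) ℤ.* + 2 - (+ 1 ℤ.+ (h ℤ.+ h))
    lem₃ = solve-∀
    lem₄ : ∀ x y z → x ℤ.* y ℤ.* z ≡ y ℤ.* (x ℤ.* z)
    lem₄ = solve-∀

  -p²≡0 : - p⁺ ℤ.* - p⁺ P².≈ + 0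
  -p²≡0 = mod (+ 1) (lem p⁺)
    where
    lem : ∀ p → - p ℤ.* - p ≡ + 0 ℤ.+ p ℤ.* p ℤ.* + 1
    lem = solve-∀

  cancel-mod-p² : ∀ c {x y} → Coprime ∣ c ∣ p → c ℤ.* x P².≈ c ℤ.* y → x P².≈ y
  cancel-mod-p² c {x} {y} c⊥p e = subst (λ m → x ≡ y [ m ]) (ℤP.pos-* p p)
    (mod-cancel c (Coprimality.sym (coprime-* (Coprimality.sym c⊥p) (Coprimality.sym c⊥p)))
      (subst (λ m → c ℤ.* x ≡ c ℤ.* y [ m ]) (≡.sym (ℤP.pos-* p p)) e))

  -- Morley's congruence, modulo p² only.
  morley : binom q h P².≈ Z.pow q (+ 4)
  morley = cancel-mod-p² (+ (h !)) (coprime-! h h≤q) (P².begin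
    F ℤ.* binom q h
      P².≡⟨ ≡.trans (binom-falling q h) (Z.Π.cong-≈ h λ l → lem₀ (+ l) (+ q)) ⟩
    R
      P².≈⟨ P².sym (conclude T A F E R O (fermat′ 2 coprime-2) (≡.sym (Z.Π.concat h h (const (+ 2))))
              R≡2ᵍO R-expansion O-expansion) ⟩
    F ℤ.* (T ℤ.* T)
      P².≡⟨ cong (F ℤ.*_) (≡.sym (Z.Π.zip q (const (+ 2)) (const (+ 2)))) ⟩
    F ℤ.* Z.pow q (+ 4) P².∎)
    where
    F E R O T A : ℤ
    F = + (h !)
    E = Z.omitted h (λ l → + suc l)
    R = Z.prod h (λ l → + suc l - p⁺)
    O = Z.prod h (λ l → + suc l ℤ.* + 2 - p⁺)
    T = Z.pow q (+ 2)
    A = Z.pow g (+ 2)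
    lem₀ : ∀ l q → l - q ≡ + 1 ℤ.+ l - (+ 1 ℤ.+ q)
    lem₀ = solve-∀
    lem₁ : ∀ x p → x - p ≡ x ℤ.* + 1 ℤ.+ - p
    lem₁ = solve-∀
    lem₂ : ∀ F E p → F ℤ.* + 1 ℤ.+ E ℤ.* + 1 ℤ.* - p ≡ F - E ℤ.* p
    lem₂ = solve-∀
    R≡2ᵍO : R P².≈ + 2 ℤ.* A ℤ.* O
    R≡2ᵍO = cancel-mod-p² (Z.prod h (λ l → + l - + h))
      (coprime-prod h (λ l → + l - + h) λ l l<h → coprime-∸ l h h≤q l<h)
      (P².reflexive half-products)
    R-expansion : R P².≈ F - E ℤ.* p⁺
    R-expansion = P².trans (P².reflexive (Z.Π.cong-≈ h λ l → lem₁ (+ suc l) p⁺))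
      (P².trans (P².prod-linear g (λ l → + suc l) (+ 1) (- p⁺) -p²≡0)
        (P².reflexive (≡.trans
          (cong₂ (λ x y → x ℤ.+ E ℤ.* y ℤ.* - p⁺) (cong₂ ℤ._*_ (prod-! h) (pow-1 h)) (pow-1 g))
          (lem₂ F E p⁺))))
    O-expansion : O P².≈ F ℤ.* (+ 2 ℤ.* A) ℤ.+ E ℤ.* A ℤ.* - p⁺
    O-expansion = P².trans (P².prod-linear g (λ l → + suc l) (+ 2) (- p⁺) -p²≡0)
      (P².reflexive (cong (λ x → x ℤ.* (+ 2 ℤ.* A) ℤ.+ E ℤ.* A ℤ.* - p⁺) (prod-! h)))
    -- Here T = 4^h and 2A = 2^h. The route through O gives 2R ≡ T (2F - Ep), the direct expansion
    -- gives R ≡ F - Ep. In the difference the unknown E drops out because T ≡ 1 mod p, leaving R ≡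
    -- F (2T - 1), and this is F T² because (T - 1)² is a multiple of p².
    conclude : ∀ T A F E R O → T P.≈ + 1 → + 2 ℤ.* A ℤ.* (+ 2 ℤ.* A) ≡ T →
      R P².≈ + 2 ℤ.* A ℤ.* O → R P².≈ F - E ℤ.* p⁺ →
      O P².≈ F ℤ.* (+ 2 ℤ.* A) ℤ.+ E ℤ.* A ℤ.* - p⁺ → F ℤ.* (T ℤ.* T) P².≈ R
    conclude T A F E R O (mod t T≡) 4A² e₁ e₂ e₃ = P².begin
      F ℤ.* (T ℤ.* T)
        P².≈⟨ step T T≡ ⟩
      T ℤ.* (+ 2 ℤ.* F - E ℤ.* p⁺) - (F - E ℤ.* p⁺)
        P².≡⟨ cong (λ T → T ℤ.* (+ 2 ℤ.* F - E ℤ.* p⁺) - (F - E ℤ.* p⁺)) (≡.sym 4A²) ⟩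
      + 2 ℤ.* A ℤ.* (+ 2 ℤ.* A) ℤ.* (+ 2 ℤ.* F - E ℤ.* p⁺) - (F - E ℤ.* p⁺)
        P².≡⟨ lem₃ A F E p⁺ ⟩
      + 2 ℤ.* (+ 2 ℤ.* A ℤ.* (F ℤ.* (+ 2 ℤ.* A) ℤ.+ E ℤ.* A ℤ.* - p⁺)) - (F - E ℤ.* p⁺)
        P².≈⟨ P².+-cong (P².*-congˡ {+ 2} (P².trans (P².*-congˡ {+ 2 ℤ.* A} (P².sym e₃)) (P².sym e₁)))
                        (P².-‿cong (P².sym e₂)) ⟩
      + 2 ℤ.* R - R
        P².≡⟨ lem₄ R ⟩
      R P².∎
      where
      lem₃ : ∀ A F E p → + 2 ℤ.* A ℤ.* (+ 2 ℤ.* A) ℤ.* (+ 2 ℤ.* F - E ℤ.* p) - (F - E ℤ.* p) ≡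
        + 2 ℤ.* (+ 2 ℤ.* A ℤ.* (F ℤ.* (+ 2 ℤ.* A) ℤ.+ E ℤ.* A ℤ.* - p)) - (F - E ℤ.* p)
      lem₃ = solve-∀
      lem₄ : ∀ R → + 2 ℤ.* R - R ≡ R
      lem₄ = solve-∀
      lem₅ : ∀ F E p t → F ℤ.* ((+ 1 ℤ.+ p ℤ.* t) ℤ.* (+ 1 ℤ.+ p ℤ.* t)) ≡
        (+ 1 ℤ.+ p ℤ.* t) ℤ.* (+ 2 ℤ.* F - E ℤ.* p) - (F - E ℤ.* p) ℤ.+
        p ℤ.* p ℤ.* (F ℤ.* t ℤ.* t ℤ.+ t ℤ.* E)
      lem₅ = solve-∀
      step : ∀ T → T ≡ + 1 ℤ.+ p⁺ ℤ.* t →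
        F ℤ.* (T ℤ.* T) P².≈ T ℤ.* (+ 2 ℤ.* F - E ℤ.* p⁺) - (F - E ℤ.* p⁺)
      step _ ≡.refl = mod (F ℤ.* t ℤ.* t ℤ.+ t ℤ.* E) (lem₅ F E p⁺ t)

  -- Twice `binom-climb` reads (1 + p) c(p, h) = 2p c(q, h), as 2 (p - h) = p + 1. Modulo p³ the
  -- inverse of 1 + p is 1 - p + p², whose last term is absorbed by the factor p on the right; the
  -- same factor makes `morley` modulo p² sufficient.
  binom-p-half : binom p h P³.≈ + 2 ℤ.* p⁺ ℤ.* (+ 1 - p⁺) ℤ.* Z.pow q (+ 4)
  binom-p-half = go (binom p h) (binom q h) (Z.pow q (+ 4)) morley
    (linear-combination {(p⁺ - + h) ℤ.* binom p h} {p⁺ ℤ.* binom q h} (+ 2) (binom-climb q h)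
      (lem₁ (+ h) (binom p h) (binom q h)))
    where
    lem₁ : ∀ h β γ → (+ 1 ℤ.+ (+ 1 ℤ.+ (h ℤ.+ h))) ℤ.* β - + 2 ℤ.* (+ 1 ℤ.+ (h ℤ.+ h)) ℤ.* γ ≡
      + 2 ℤ.* ((+ 1 ℤ.+ (h ℤ.+ h) - h) ℤ.* β - (+ 1 ℤ.+ (h ℤ.+ h)) ℤ.* γ)
    lem₁ = solve-∀
    lem₂ : ∀ p β T s →
      β - (+ 2 ℤ.* p ℤ.* (+ 1 - p) ℤ.* T ℤ.+
           p ℤ.* p ℤ.* p ℤ.* (+ 2 ℤ.* (+ 1 - p) ℤ.* s ℤ.+ (+ 2 ℤ.* (T ℤ.+ p ℤ.* p ℤ.* s) - β))) ≡
      (+ 1 - p ℤ.+ p ℤ.* p) ℤ.* ((+ 1 ℤ.+ p) ℤ.* β - + 2 ℤ.* p ℤ.* (T ℤ.+ p ℤ.* p ℤ.* s))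
    lem₂ = solve-∀
    go : ∀ β γ T → γ P².≈ T → (+ 1 ℤ.+ p⁺) ℤ.* β ≡ + 2 ℤ.* p⁺ ℤ.* γ →
      β P³.≈ + 2 ℤ.* p⁺ ℤ.* (+ 1 - p⁺) ℤ.* T
    -- The quotient collects 2 (1 - p) s from γ = T + p² s, and 2γ - β from (1 + p)(1 - p + p²) = 1
    -- + p³.
    go β _ T (mod s ≡.refl) e = mod (+ 2 ℤ.* (+ 1 - p⁺) ℤ.* s ℤ.+ (+ 2 ℤ.* (T ℤ.+ p⁺ ℤ.* p⁺ ℤ.* s) - β))
      (linear-combination {(+ 1 ℤ.+ p⁺) ℤ.* β} (+ 1 - p⁺ ℤ.+ p⁺ ℤ.* p⁺) e (lem₂ p⁺ β T s))

  -- For r = 0 the series of the `b j 0` is 1 and `v-factor` splits off exactly p², so the remaining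
  -- coefficient is needed modulo p³ only. The factor w of v raises w^q to w^p.
  v-mod-p⁵ : Coprime 3 p → v (suc (suc h)) ≡
    + 2 ℤ.* (p⁺ ℤ.* p⁺ ℤ.* p⁺) ℤ.* (+ 1 - p⁺) ℤ.* + (q !) ℤ.* Z.pow q (+ 4)
    [ p⁺ ℤ.* p⁺ ℤ.* (p⁺ ℤ.* p⁺ ℤ.* p⁺) ]
  v-mod-p⁵ 3⊥p = subst (λ x → x ≡ target [ p⁺ ℤ.* p⁺ ℤ.* (p⁺ ℤ.* p⁺ ℤ.* p⁺) ]) (≡.sym v≡)
    (subst (λ y → p⁺ ℤ.* p⁺ ℤ.* ((λ j → b j 0) ⋆ (W ⋆ units 1 q)) h ≡ y [ p⁺ ℤ.* p⁺ ℤ.* (p⁺ ℤ.* p⁺ ℤ.* p⁺) ])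
      (lem₂ p⁺ (+ (q !)) (Z.pow q (+ 4))) (mod-scale (p⁺ ℤ.* p⁺) core))
    where
    target : ℤ
    target = + 2 ℤ.* (p⁺ ℤ.* p⁺ ℤ.* p⁺) ℤ.* (+ 1 - p⁺) ℤ.* + (q !) ℤ.* Z.pow q (+ 4)
    lem₁ : ∀ p x → + 1 ℤ.* + 1 ℤ.* (p ℤ.* (p ℤ.* + 1)) ℤ.* x ≡ p ℤ.* p ℤ.* x
    lem₁ = solve-∀
    lem₂ : ∀ p F T → p ℤ.* p ℤ.* (F ℤ.* (+ 2 ℤ.* p ℤ.* (+ 1 - p) ℤ.* T)) ≡
      + 2 ℤ.* (p ℤ.* p ℤ.* p) ℤ.* (+ 1 - p) ℤ.* F ℤ.* T
    lem₂ = solve-∀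
    index : suc h ℕ.+ suc h ≡ suc (1 ℕ.* p)
    index = ≡.trans (cong suc (ℕP.+-suc h h)) (cong suc (≡.sym (ℕP.*-identityˡ p)))
    v≡ : v (suc (suc h)) ≡ p⁺ ℤ.* p⁺ ℤ.* ((λ j → b j 0) ⋆ (W ⋆ units 1 q)) h
    v≡ = ≡.trans (v-factor q 0 h index) (lem₁ p⁺ (((λ j → b j 0) ⋆ (W ⋆ units 1 q)) h))
    core : ((λ j → b j 0) ⋆ (W ⋆ units 1 q)) h P³.≈
      + (q !) ℤ.* (+ 2 ℤ.* p⁺ ℤ.* (+ 1 - p⁺) ℤ.* Z.pow q (+ 4))
    core = P³.begin
      ((λ j → b j 0) ⋆ (W ⋆ units 1 q)) h
        P³.≡⟨ ≡.trans (PSℤ.⋆-cong {g = W ⋆ units 1 q} (b-coeff 0) (λ _ → ≡.refl) h)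
                      (PSℤ.⋆-identityˡ (W ⋆ units 1 q) h) ⟩
      (W ⋆ units 1 q) h
        P³.≈⟨ PSc.⋆-cong {W} (λ _ → P³.refl) (units-cubic 3⊥p) h ⟩
      (W ⋆ (K (+ (q !)) ⋆ S.pow q W)) h
        P³.≡⟨ S.Π.leftCommute W (K (+ (q !))) (S.pow q W) h ⟩
      (K (+ (q !)) ⋆ S.pow p W) h
        P³.≡⟨ ≡.trans (PSℤ.K-⋆ (+ (q !)) (S.pow p W) h) (cong (+ (q !) ℤ.*_) (W-pow p h)) ⟩
      + (q !) ℤ.* binom p h
        P³.≈⟨ P³.*-congˡ {+ (q !)} binom-p-half ⟩
      + (q !) ℤ.* (+ 2 ℤ.* p⁺ ℤ.* (+ 1 - p⁺) ℤ.* Z.pow q (+ 4)) P³.∎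

-- Part 2: the case r ≥ 1

module Blocks (g : ℕ) (prime : Prime (suc (suc g ℕ.+ suc g))) (r′ : ℕ)
  (2r<p : 2 ℕ.* suc r′ ℕ.< suc (suc g ℕ.+ suc g)) where
  open OddPrime g prime

  -- With D = a p: N = D - 2r is the total exponent of w, namely 1 from v and a q from the units; s
  -- is the number of steps from row N to row D - 1; and k₀ + 2 is the index of v.
  r s a N k₀ : ℕ
  r  = suc r′
  s  = 2 ℕ.* r ℕ.∸ 1
  a  = suc (2 ℕ.* r)
  N  = suc (a ℕ.* q)
  k₀ = h ℕ.+ r ℕ.* p

  s≤q : s ℕ.≤ q
  s≤q = ℕP.≤-trans (ℕP.n≤1+n s) (ℕP.≤-pred 2r<p)

  r≤q : r ℕ.≤ q
  r≤q = ℕP.≤-trans (ℕP.m≤m+n r (r ℕ.+ 0)) (ℕP.≤-pred 2r<p)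

  sign : ℤ
  sign = Z.pow r (- + 1)

  sign-odd : Z.pow a (- + 1) ≡ - + 1
  sign-odd = cong (- + 1 ℤ.*_) (≡.trans (pow-double r (- + 1)) (pow-1 r))

  -- An index congruent to m = k + 1 gives the factor -m + m x = -m w modulo p. The scalar is
  -- written p - m, so that a block of scalars multiplies to q!.
  factor-mod : ∀ i k → i ℕ.< a → k ℕ.< q →
    Linear (+ (a ℕ.* p ℕ.∸ suc (i ℕ.* p ℕ.+ k))) (+ suc (i ℕ.* p ℕ.+ k)) Sp.≈ K (+ (q ℕ.∸ k)) ⋆ W
  factor-mod i k i<a k<q = Sp.trans
    (PSp.linear-cong
      (P.trans (P.reflexive difference) (P.trans (P.trans (P.+-cong (P.refl {+ (a ℕ.* p)}) (P.-‿cong index)) multiple)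
        (P.sym (∸≡- (ℕP.<⇒≤ k<q)))))
      (P.trans index (P.trans (P.reflexive (≡.sym (ℤP.neg-involutive (+ suc k))))
        (P.-‿cong (P.sym (∸≡- (ℕP.<⇒≤ k<q)))))))
    (λ j → P.reflexive (linear-W (+ (q ℕ.∸ k)) j))
    where
    J : ℕ
    J = suc (i ℕ.* p ℕ.+ k)
    J≤ : J ℕ.≤ a ℕ.* p
    J≤ = ℕP.≤-trans (s≤s (subst (i ℕ.* p ℕ.+ k ℕ.≤_) (ℕP.+-comm (i ℕ.* p) q)
      (ℕP.+-monoʳ-≤ (i ℕ.* p) (ℕP.<⇒≤ k<q)))) (ℕP.*-monoˡ-≤ p i<a)
    difference : + (a ℕ.* p ℕ.∸ J) ≡ + (a ℕ.* p) - + J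
    difference = pos-∸ J≤
    lem₁ : ∀ i p k → + 1 ℤ.+ (i ℤ.* p ℤ.+ k) ≡ + 1 ℤ.+ k ℤ.+ p ℤ.* i
    lem₁ = solve-∀
    index : + J P.≈ + suc k
    index = mod (+ i) (≡.trans (cong (λ x → + 1 ℤ.+ (x ℤ.+ + k)) (ℤP.pos-* i p)) (lem₁ (+ i) p⁺ (+ k)))
    lem₂ : ∀ a p k → a ℤ.* p - k ≡ - k ℤ.+ p ℤ.* a
    lem₂ = solve-∀
    multiple : + (a ℕ.* p) - + suc k P.≈ - + suc k
    multiple = mod (+ a) (≡.trans (cong (_- + suc k) (ℤP.pos-* a p)) (lem₂ (+ a) p⁺ (+ suc k)))

  units-mod : units a q Sp.≈ K (- + 1) ⋆ S.pow (a ℕ.* q) W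
  units-mod = Sp.begin
    units a q
      Sp.≈⟨ Sp.Π.cong-< a (λ i i<a → Sp.Π.cong-< q λ k k<q → factor-mod i k i<a k<q) ⟩
    S.pow a (S.prod q (λ k → K (+ (q ℕ.∸ k)) ⋆ W))
      Sp.≈⟨ Sp.pow-cong a block ⟩
    S.pow a (K (- + 1) ⋆ S.pow q W)
      Sp.≈⟨ (λ k → P.reflexive (collect k)) ⟩
    K (- + 1) ⋆ S.pow (a ℕ.* q) W Sp.∎
    where
    block : S.prod q (λ k → K (+ (q ℕ.∸ k)) ⋆ W) Sp.≈ K (- + 1) ⋆ S.pow q W
    block = Sp.trans (Sp.Π.zip q (λ k → K (+ (q ℕ.∸ k))) (const W))
      (PSp.⋆-cong {g = S.pow q W} (Sp.trans (Sp.sym (PSp.K-prod q (λ k → + (q ℕ.∸ k))))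
        (PSp.K-cong (P.trans (P.reflexive (prod-!-reverse q)) wilson))) (λ _ → P.refl))
    collect : S.pow a (K (- + 1) ⋆ S.pow q W) S.≈ K (- + 1) ⋆ S.pow (a ℕ.* q) W
    collect = S.trans (S.prod-scale a (K (- + 1)) (const (S.pow q W)))
      (PSℤ.⋆-cong (S.trans (S.sym (PSℤ.K-prod a (const (- + 1)))) (PSℤ.K-cong sign-odd))
                  (S.sym (S.Π.blocks a q (const W))))

  2r≤k₀ : 2 ℕ.* r ℕ.≤ k₀
  2r≤k₀ = ℕP.≤-trans (ℕP.≤-reflexive (ℕP.*-comm 2 r))
    (ℕP.≤-trans (ℕP.*-monoʳ-≤ r (s≤s (s≤s z≤n))) (ℕP.m≤n+m (r ℕ.* p) h))

  moment : ℤ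
  moment = Z.sum a (λ j → b j r ℤ.* binom N (k₀ ℕ.∸ j))

  coefficient-mod : ((λ j → b j r) ⋆ (W ⋆ units a q)) k₀ P.≈ - moment
  coefficient-mod = P.begin
    (B ⋆ (W ⋆ units a q)) k₀
      P.≈⟨ PSp.⋆-cong {B} (λ _ → P.refl) (PSp.⋆-cong {W} (λ _ → P.refl) units-mod) k₀ ⟩
    (B ⋆ (W ⋆ (K (- + 1) ⋆ S.pow (a ℕ.* q) W))) k₀
      P.≡⟨ S.trans (PSℤ.⋆-cong {B} (λ _ → ≡.refl) (S.Π.leftCommute W (K (- + 1)) (S.pow (a ℕ.* q) W)))
                   (S.Π.leftCommute B (K (- + 1)) (S.pow N W)) k₀ ⟩
    (K (- + 1) ⋆ (B ⋆ S.pow N W)) k₀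
      P.≡⟨ PSℤ.K-⋆ (- + 1) (B ⋆ S.pow N W) k₀ ⟩
    - + 1 ℤ.* (B ⋆ S.pow N W) k₀
      P.≡⟨ cong (- + 1 ℤ.*_) (≡.trans (PSℤ.⋆-cong {B} (λ _ → ≡.refl) (W-pow N) k₀)
             (PSℤ.⋆-sum B (binom N) k₀)) ⟩
    - + 1 ℤ.* Z.sum (suc k₀) T
      -- The polynomial of the `b j r` has degree at most 2r, and 2r ≤ k₀, so the convolution sum
      -- can be cut after its first a = 2r + 1 terms.
      P.≡⟨ cong (λ n → - + 1 ℤ.* Z.sum (suc n) T) (≡.sym (ℕP.m+[n∸m]≡n 2r≤k₀)) ⟩
    - + 1 ℤ.* Z.sum (a ℕ.+ (k₀ ℕ.∸ 2 ℕ.* r)) T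
      P.≡⟨ cong (- + 1 ℤ.*_) (Z.Σ.concat a (k₀ ℕ.∸ 2 ℕ.* r) T) ⟩
    - + 1 ℤ.* (moment ℤ.+ Z.sum (k₀ ℕ.∸ 2 ℕ.* r) (λ i → T (a ℕ.+ i)))
      P.≡⟨ cong (λ x → - + 1 ℤ.* (moment ℤ.+ x)) tail ⟩
    - + 1 ℤ.* (moment ℤ.+ + 0)
      P.≡⟨ lem moment ⟩
    - moment P.∎
    where
    B T : ℕ → ℤ
    B j = b j r
    T j = B j ℤ.* binom N (k₀ ℕ.∸ j)
    lem : ∀ x → - + 1 ℤ.* (x ℤ.+ + 0) ≡ - x
    lem = solve-∀
    tail : Z.sum (k₀ ℕ.∸ 2 ℕ.* r) (λ i → T (a ℕ.+ i)) ≡ + 0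
    tail = ≡.trans (Z.Σ.cong-≈ (k₀ ℕ.∸ 2 ℕ.* r) λ i → ≡.trans
        (cong (ℤ._* binom N (k₀ ℕ.∸ (a ℕ.+ i))) (≡.trans (b-coeff r (a ℕ.+ i))
          (prod-linear-degree (2 ℕ.* r) (λ i → + (2 ℕ.* r ℕ.∸ i)) (λ i → + suc i) (a ℕ.+ i) (ℕP.m≤m+n a i))))
        (ℤP.*-zeroˡ (binom N (k₀ ℕ.∸ (a ℕ.+ i)))))
      (Z.Σ.fold-ε (k₀ ℕ.∸ 2 ℕ.* r))

  -- The residue of (N + 1) ... (N + s): as N + s = D - 1, the factors are -s, ..., -1 modulo p.
  Nₛ : ℤ
  Nₛ = Z.prod s (λ i → + i - + s)

  coprime-Nₛ : Coprime ∣ Nₛ ∣ p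
  coprime-Nₛ = coprime-prod s (λ i → + i - + s) λ i i<s → coprime-∸ i s s≤q i<s

  -- Both sides are ∏ (l - 2r) over 0 ≤ l < 2r, split once in the middle and once after l = 0. It
  -- brings `Nₛ` out of the Lucas value, to be cancelled against the `Nₛ` of the climb.
  prod-split : Z.prod r (λ l → + l - + (2 ℕ.* r)) ℤ.* (sign ℤ.* + (r !)) ≡ - + (2 ℕ.* r) ℤ.* Nₛ
  prod-split = begin
    Z.prod r f ℤ.* (sign ℤ.* + (r !))
      ≡⟨ cong (Z.prod r f ℤ.*_) (≡.sym (prod-negative r)) ⟩
    Z.prod r f ℤ.* Z.prod r (λ l → + l - + r)
      ≡⟨ cong (Z.prod r f ℤ.*_) (Z.Π.cong-≈ r λ l → ≡.trans (lem₁ (+ l) (+ r))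
           (cong (λ n → + r ℤ.+ + l - + n) (cong (r ℕ.+_) (≡.sym (ℕP.+-identityʳ r))))) ⟩
    Z.prod r f ℤ.* Z.prod r (λ l → f (r ℕ.+ l))
      ≡⟨ ≡.sym (Z.Π.concat r r f) ⟩
    Z.prod (r ℕ.+ r) f
      ≡⟨ cong (λ n → Z.prod (r ℕ.+ n) f) (≡.sym (ℕP.+-identityʳ r)) ⟩
    (+ 0 - + suc s) ℤ.* Z.prod s (λ l → + suc l - + suc s)
      ≡⟨ cong₂ ℤ._*_ (ℤP.+-identityˡ (- + suc s)) (Z.Π.cong-≈ s λ l → lem₂ (+ l) (+ s)) ⟩
    - + suc s ℤ.* Nₛ ∎
    where
    open ≡.≡-Reasoning
    f : ℕ → ℤ
    f l = + l - + (2 ℕ.* r)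
    lem₁ : ∀ l r → l - r ≡ r ℤ.+ l - (r ℤ.+ r)
    lem₁ = solve-∀
    lem₂ : ∀ l s → + 1 ℤ.+ l - (+ 1 ℤ.+ s) ≡ l - s
    lem₂ = solve-∀

  u : ℕ → ℤ
  u j = + 1 - + (2 ℕ.* j)

  -- The row D - 1, in the form that `binom-block` and `binom-lucas` expect.
  top : ℕ
  top = q ℕ.+ 2 ℕ.* r ℕ.* p

  top≡ : s ℕ.+ N ≡ top
  top≡ = lem s q
    where
    lem : ∀ s q → s ℕ.+ suc (suc (suc s) ℕ.* q) ≡ q ℕ.+ suc s ℕ.* suc q
    lem = ℕSolver.solve-∀

  N≡ : ∀ i → + suc (i ℕ.+ N) ≡ + i - + s ℤ.+ p⁺ ℤ.* + a
  N≡ i = ≡.trans (cong (λ x → + 1 ℤ.+ (+ i ℤ.+ (+ 1 ℤ.+ x))) (ℤP.pos-* a q)) (lem (+ i) (+ s) (+ q))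
    where
    lem : ∀ i s q → + 1 ℤ.+ (i ℤ.+ (+ 1 ℤ.+ (+ 2 ℤ.+ s) ℤ.* q)) ≡
      i - s ℤ.+ (+ 1 ℤ.+ q) ℤ.* (+ 2 ℤ.+ s)
    lem = solve-∀

  -- Because 2 k₀ ≡ 2h ≡ -1 mod p, doubling the i-th factor gives -(1 - 2j + 2 (s - 1 - i)): the
  -- factors of the double factorial in reverse order, with an odd number s of signs.
  rise-left : ∀ j → j ℕ.≤ 2 ℕ.* r →
    Z.pow s (+ 2) ℤ.* Z.prod s (λ i → + suc (i ℕ.+ N) - + (k₀ ℕ.∸ j)) P.≈ - dfact (u j) s
  rise-left j j≤2r = P.begin
    Z.pow s (+ 2) ℤ.* Z.prod s (λ i → + suc (i ℕ.+ N) - + (k₀ ℕ.∸ j))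
      P.≡⟨ ≡.sym (Z.prod-scale s (+ 2) (λ i → + suc (i ℕ.+ N) - + (k₀ ℕ.∸ j))) ⟩
    Z.prod s (λ i → + 2 ℤ.* (+ suc (i ℕ.+ N) - + (k₀ ℕ.∸ j)))
      P.≈⟨ P.Π.cong-< s step ⟩
    Z.prod s (λ i → - + 1 ℤ.* f (s ℕ.∸ suc i))
      P.≡⟨ Z.prod-scale s (- + 1) (λ i → f (s ℕ.∸ suc i)) ⟩
    Z.pow s (- + 1) ℤ.* Z.prod s (λ i → f (s ℕ.∸ suc i))
      P.≡⟨ cong₂ ℤ._*_ sign-s (≡.trans (≡.sym (Z.Π.reverse s f)) (≡.sym (dfact-prod (u j) s))) ⟩
    - + 1 ℤ.* dfact (u j) s
      P.≡⟨ ℤP.-1*i≡-i (dfact (u j) s) ⟩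
    - dfact (u j) s P.∎
    where
    f : ℕ → ℤ
    f i = u j ℤ.+ + (2 ℕ.* i)
    sign-s : Z.pow s (- + 1) ≡ - + 1
    sign-s = ≡.trans (lem₁ (Z.pow s (- + 1)))
      (cong (- + 1 ℤ.*_) (≡.trans (pow-double r (- + 1)) (pow-1 r)))
      where
      lem₁ : ∀ x → x ≡ - + 1 ℤ.* (- + 1 ℤ.* x)
      lem₁ = solve-∀
    lem : ∀ i s j h p r k d N P → d ≡ s - (+ 1 ℤ.+ i) → k ≡ h ℤ.+ r ℤ.* p - j → p ≡ + 1 ℤ.+ (h ℤ.+ h) →
      N ≡ i - s ℤ.+ p ℤ.* P →
      + 2 ℤ.* (N - k) ≡ - + 1 ℤ.* (+ 1 - + 2 ℤ.* j ℤ.+ + 2 ℤ.* d) ℤ.+ p ℤ.* (+ 2 ℤ.* P - + 2 ℤ.* r - + 1)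
    lem i s j h _ r _ _ _ P ≡.refl ≡.refl ≡.refl ≡.refl = go i s j h r P
      where
      go : ∀ i s j h r P →
        + 2 ℤ.* (i - s ℤ.+ (+ 1 ℤ.+ (h ℤ.+ h)) ℤ.* P - (h ℤ.+ r ℤ.* (+ 1 ℤ.+ (h ℤ.+ h)) - j)) ≡
        - + 1 ℤ.* (+ 1 - + 2 ℤ.* j ℤ.+ + 2 ℤ.* (s - (+ 1 ℤ.+ i))) ℤ.+
        (+ 1 ℤ.+ (h ℤ.+ h)) ℤ.* (+ 2 ℤ.* P - + 2 ℤ.* r - + 1)
      go = solve-∀
    step : ∀ i → i ℕ.< s → + 2 ℤ.* (+ suc (i ℕ.+ N) - + (k₀ ℕ.∸ j)) P.≈ - + 1 ℤ.* f (s ℕ.∸ suc i)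
    step i i<s = mod (+ 2 ℤ.* + a - + 2 ℤ.* + r - + 1) (≡.trans
      (lem (+ i) (+ s) (+ j) (+ h) p⁺ (+ r) (+ (k₀ ℕ.∸ j)) (+ (s ℕ.∸ suc i)) (+ suc (i ℕ.+ N)) (+ a)
        (pos-∸ i<s)
        (≡.trans (pos-∸ (ℕP.≤-trans j≤2r 2r≤k₀)) (cong (λ x → + h ℤ.+ x - + j) (ℤP.pos-* r p)))
        ≡.refl (N≡ i))
      (cong₂ (λ x y → - + 1 ℤ.* (+ 1 - x ℤ.+ y) ℤ.+ p⁺ ℤ.* (+ 2 ℤ.* + a - + 2 ℤ.* + r - + 1))
        (≡.sym (ℤP.pos-* 2 j)) (≡.sym (ℤP.pos-* 2 (s ℕ.∸ suc i)))))

  rise-right : Z.prod s (λ i → + suc (i ℕ.+ N)) P.≈ Nₛ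
  rise-right = P.Π.cong-≈ s λ i → mod (+ a) (N≡ i)

  -- The factor with i = j - h - 1 equals 1 - 2j + 2i = -p, and j ≤ 2r ensures i < s.
  dfact-vanish : ∀ j → h ℕ.< j → j ℕ.≤ 2 ℕ.* r → dfact (u j) s P.≈ + 0
  dfact-vanish j h<j j≤2r = P.trans (P.reflexive (dfact-prod (u j) s))
    (prod-zero s (λ i → u j ℤ.+ + (2 ℕ.* i)) (j ℕ.∸ suc h) bound zero-factor)
    where
    prod-zero : ∀ n f i → i ℕ.< n → f i P.≈ + 0 → Z.prod n f P.≈ + 0
    prod-zero (suc n) f zero    i<n       e = P.trans (P.*-congʳ {Z.prod n (f ∘ suc)} e) (P.zeroˡ (Z.prod n (f ∘ suc)))
    prod-zero (suc n) f (suc i) (s≤s i<n) e = P.trans (P.*-congˡ {f 0} (prod-zero n (f ∘ suc) i i<n e)) (P.zeroʳ (f 0))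
    bound : j ℕ.∸ suc h ℕ.< s
    bound = ℕP.<-≤-trans (ℕP.∸-monoʳ-< {j} (s≤s (s≤s z≤n)) h<j) (ℕP.∸-monoˡ-≤ 1 j≤2r)
    lem : ∀ j h → + 1 - + 2 ℤ.* j ℤ.+ + 2 ℤ.* (j - (+ 1 ℤ.+ h)) ≡ + 0 ℤ.+ (+ 1 ℤ.+ (h ℤ.+ h)) ℤ.* - + 1
    lem = solve-∀
    zero-factor : u j ℤ.+ + (2 ℕ.* (j ℕ.∸ suc h)) P.≈ + 0
    zero-factor = mod (- + 1) (≡.trans (cong₂ (λ x y → + 1 - x ℤ.+ y) (ℤP.pos-* 2 j)
      (≡.trans (ℤP.pos-* 2 (j ℕ.∸ suc h)) (cong (+ 2 ℤ.*_) (pos-∸ h<j)))) (lem (+ j) (+ h)))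

  -- For j > h the index k₀ - j leaves the block of binom-block, but then the weight vanishes.
  weighted-lucas : ∀ j → j ℕ.≤ 2 ℕ.* r →
    dfact (u j) s ℤ.* (sign ℤ.* + (r !) ℤ.* (+ (r !) ℤ.* binom top (k₀ ℕ.∸ j))) P.≈
    dfact (u j) s ℤ.* (- + (2 ℕ.* r) ℤ.* Nₛ)
  weighted-lucas j j≤2r with j ℕ.≤? h
  ... | no  j≰h = P.trans (zeros (sign ℤ.* + (r !) ℤ.* (+ (r !) ℤ.* binom top (k₀ ℕ.∸ j))))
                          (P.sym (zeros (- + (2 ℕ.* r) ℤ.* Nₛ)))
    where
    zeros : ∀ x → dfact (u j) s ℤ.* x P.≈ + 0
    zeros x = P.trans (P.*-congʳ {x} (dfact-vanish j (ℕP.≰⇒> j≰h) j≤2r)) (P.zeroˡ x)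
  ... | yes j≤h = P.*-congˡ {dfact (u j) s} (P.begin
    sign ℤ.* + (r !) ℤ.* (+ (r !) ℤ.* binom top (k₀ ℕ.∸ j))
      P.≡⟨ cong (λ k → sign ℤ.* + (r !) ℤ.* (+ (r !) ℤ.* binom top k)) index ⟩
    sign ℤ.* + (r !) ℤ.* (+ (r !) ℤ.* binom top (r ℕ.* p ℕ.+ (h ℕ.∸ j)))
      P.≈⟨ P.*-congˡ {sign ℤ.* + (r !)} (P.trans
             (P.*-congˡ {+ (r !)} (binom-block (2 ℕ.* r) r (h ℕ.∸ j) (ℕP.≤-trans (ℕP.m∸n≤m h j) h≤q)))
             (binom-lucas (2 ℕ.* r) r)) ⟩
    sign ℤ.* + (r !) ℤ.* Z.prod r (λ l → + l - + (2 ℕ.* r))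
      P.≡⟨ ≡.trans (ℤP.*-comm (sign ℤ.* + (r !)) _) prod-split ⟩
    - + (2 ℕ.* r) ℤ.* Nₛ P.∎)
    where
    index : k₀ ℕ.∸ j ≡ r ℕ.* p ℕ.+ (h ℕ.∸ j)
    index = ≡.trans (cong (ℕ._∸ j) (ℕP.+-comm h (r ℕ.* p))) (ℕP.+-∸-assoc (r ℕ.* p) j≤h)

  pow-s : Z.pow s (+ 2) ≡ + 2 ℤ.* Z.pow r′ (+ 4)
  pow-s = ℤP.*-cancelˡ-≡ (+ 2) _ _ (≡.trans (pow-double r (+ 2)) (lem (Z.pow r′ (+ 4))))
    where
    lem : ∀ x → + 4 ℤ.* x ≡ + 2 ℤ.* (+ 2 ℤ.* x)
    lem = solve-∀

  den : ℤ
  den = Z.pow r′ (+ 4) ℤ.* (+ (r !) ℤ.* + (r !))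

  -- `binom-rise` from row N to row D - 1, with everything multiplied by 2 `Nₛ`. The power 2^s = 2 ·
  -- 4^(r-1) pays for `rise-left`, one r! for Lucas, and the other r! with its sign for
  -- `prod-split`.
  term-mod : ∀ j → j ℕ.≤ 2 ℕ.* r →
    den ℤ.* binom N (k₀ ℕ.∸ j) P.≈ sign ℤ.* + r ℤ.* dfact (u j) s
  term-mod j j≤2r = mod-cancel (+ 2) coprime-2 (mod-cancel Nₛ coprime-Nₛ (P.begin
    Nₛ ℤ.* (+ 2 ℤ.* (den ℤ.* β))
      -- The sign is inserted twice, its square being 1: one copy is consumed by `prod-split`, the
      -- other remains in the result.
      P.≡⟨ lem₁ Nₛ (Z.pow r′ (+ 4)) F β {sign} (sign-square r) ⟩
    sign ℤ.* (sign ℤ.* F ℤ.* F) ℤ.* (+ 2 ℤ.* Z.pow r′ (+ 4)) ℤ.* (Nₛ ℤ.* β)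
      P.≡⟨ cong (λ x → sign ℤ.* (sign ℤ.* F ℤ.* F) ℤ.* x ℤ.* (Nₛ ℤ.* β)) (≡.sym pow-s) ⟩
    sign ℤ.* (sign ℤ.* F ℤ.* F) ℤ.* E ℤ.* (Nₛ ℤ.* β)
      P.≈⟨ P.*-congˡ {sign ℤ.* (sign ℤ.* F ℤ.* F) ℤ.* E} (P.trans (P.*-congʳ {β} (P.sym rise-right))
             (P.reflexive (≡.trans (≡.sym (binom-rise s N k)) (cong (λ n → Y ℤ.* binom n k) top≡)))) ⟩
    sign ℤ.* (sign ℤ.* F ℤ.* F) ℤ.* E ℤ.* (Y ℤ.* γ)
      P.≡⟨ lem₂ sign F E Y γ ⟩
    sign ℤ.* (sign ℤ.* F ℤ.* (F ℤ.* γ)) ℤ.* (E ℤ.* Y)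
      P.≈⟨ P.*-congˡ {sign ℤ.* (sign ℤ.* F ℤ.* (F ℤ.* γ))} (rise-left j j≤2r) ⟩
    sign ℤ.* (sign ℤ.* F ℤ.* (F ℤ.* γ)) ℤ.* - δ
      P.≡⟨ lem₃ sign (sign ℤ.* F ℤ.* (F ℤ.* γ)) δ ⟩
    - sign ℤ.* (δ ℤ.* (sign ℤ.* F ℤ.* (F ℤ.* γ)))
      P.≈⟨ P.*-congˡ { - sign} (weighted-lucas j j≤2r) ⟩
    - sign ℤ.* (δ ℤ.* (- + (2 ℕ.* r) ℤ.* Nₛ))
      P.≡⟨ cong (λ x → - sign ℤ.* (δ ℤ.* (- x ℤ.* Nₛ))) (ℤP.pos-* 2 r) ⟩
    - sign ℤ.* (δ ℤ.* (- (+ 2 ℤ.* + r) ℤ.* Nₛ))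
      P.≡⟨ lem₄ sign δ (+ r) Nₛ ⟩
    Nₛ ℤ.* (+ 2 ℤ.* (sign ℤ.* + r ℤ.* δ)) P.∎))
    where
    k : ℕ
    k = k₀ ℕ.∸ j
    β γ δ F E Y : ℤ
    β = binom N k
    γ = binom top k
    δ = dfact (u j) s
    F = + (r !)
    E = Z.pow s (+ 2)
    Y = Z.prod s (λ i → + suc (i ℕ.+ N) - + k)
    lem₁ : ∀ n x F β {σ} → σ ℤ.* σ ≡ + 1 →
      n ℤ.* (+ 2 ℤ.* (x ℤ.* (F ℤ.* F) ℤ.* β)) ≡ σ ℤ.* (σ ℤ.* F ℤ.* F) ℤ.* (+ 2 ℤ.* x) ℤ.* (n ℤ.* β)
    lem₁ n x F β {σ} e = linear-combination {σ ℤ.* σ} {+ 1} (- (n ℤ.* (+ 2 ℤ.* (x ℤ.* (F ℤ.* F) ℤ.* β)))) e (go n x F β σ)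
      where
      go : ∀ n x F β σ →
        n ℤ.* (+ 2 ℤ.* (x ℤ.* (F ℤ.* F) ℤ.* β)) - σ ℤ.* (σ ℤ.* F ℤ.* F) ℤ.* (+ 2 ℤ.* x) ℤ.* (n ℤ.* β) ≡
        - (n ℤ.* (+ 2 ℤ.* (x ℤ.* (F ℤ.* F) ℤ.* β))) ℤ.* (σ ℤ.* σ - + 1)
      go = solve-∀
    lem₂ : ∀ σ F E Y γ → σ ℤ.* (σ ℤ.* F ℤ.* F) ℤ.* E ℤ.* (Y ℤ.* γ) ≡ σ ℤ.* (σ ℤ.* F ℤ.* (F ℤ.* γ)) ℤ.* (E ℤ.* Y)
    lem₂ = solve-∀
    lem₃ : ∀ σ x δ → σ ℤ.* x ℤ.* - δ ≡ - σ ℤ.* (δ ℤ.* x)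
    lem₃ = solve-∀
    lem₄ : ∀ σ δ r n → - σ ℤ.* (δ ℤ.* (- (+ 2 ℤ.* r) ℤ.* n)) ≡ n ℤ.* (+ 2 ℤ.* (σ ℤ.* r ℤ.* δ))
    lem₄ = solve-∀

  moment-mod : den ℤ.* moment P.≈ sign ℤ.* + r ℤ.* Ssum r
  moment-mod = P.begin
    den ℤ.* moment
      P.≡⟨ Z.*-sum den a (λ j → b j r ℤ.* binom N (k₀ ℕ.∸ j)) ⟩
    Z.sum a (λ j → den ℤ.* (b j r ℤ.* binom N (k₀ ℕ.∸ j)))
      P.≈⟨ P.Σ.cong-< a step ⟩
    Z.sum a (λ j → sign ℤ.* + r ℤ.* (b j r ℤ.* dfact (u j) s))
      P.≡⟨ ≡.sym (Z.*-sum (sign ℤ.* + r) a (λ j → b j r ℤ.* dfact (u j) s)) ⟩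
    sign ℤ.* + r ℤ.* Z.sum a (λ j → b j r ℤ.* dfact (u j) s)
      P.≡⟨ cong (sign ℤ.* + r ℤ.*_) (≡.sym (sumℤ-sum (λ j → b j r ℤ.* dfact (u j) s) a)) ⟩
    sign ℤ.* + r ℤ.* Ssum r P.∎
    where
    swap : ∀ x y z → x ℤ.* (y ℤ.* z) ≡ y ℤ.* (x ℤ.* z)
    swap = solve-∀
    step : ∀ j → j ℕ.< a → den ℤ.* (b j r ℤ.* binom N (k₀ ℕ.∸ j)) P.≈ sign ℤ.* + r ℤ.* (b j r ℤ.* dfact (u j) s)
    step j (s≤s j≤2r) = P.trans (P.reflexive (swap den (b j r) (binom N (k₀ ℕ.∸ j))))
      (P.trans (P.*-congˡ {b j r} (term-mod j j≤2r))
        (P.reflexive (swap (b j r) (sign ℤ.* + r) (dfact (u j) s))))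

  numerator : ℤ
  numerator = Z.pow r′ (- + 1) ℤ.* + r ℤ.* (+ a ℤ.* + a) ℤ.* Ssum r

  -- `v-factor` provides a² p^(2r+2), so a congruence modulo p for the remaining coefficient
  -- suffices. Wilson's minus sign turns (-1)^r into the (-1)^(r-1) of C_r.
  v-multiple : den ℤ.* v (suc (suc k₀)) ≡ numerator ℤ.* (p⁺ ℤ.* Z.pow a p⁺) [ p⁺ ℤ.* Z.pow a p⁺ ℤ.* p⁺ ]
  v-multiple = subst (λ x → x ≡ numerator ℤ.* Q [ Q ℤ.* p⁺ ]) (≡.sym v≡)
    (subst (λ y → A² ℤ.* Q ℤ.* (den ℤ.* G) ≡ y [ Q ℤ.* p⁺ ]) (lem₃ (+ a) Q (Z.pow r′ (- + 1)) (+ r) (Ssum r))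
      -- Scaling the congruence also puts a² into the modulus, where it is dropped again.
      (mod-weaken A² (subst (λ m → A² ℤ.* Q ℤ.* (den ℤ.* G) ≡ A² ℤ.* Q ℤ.* (- (sign ℤ.* + r ℤ.* Ssum r)) [ m ])
        (ℤP.*-assoc A² Q p⁺) (mod-scale (A² ℤ.* Q) core))))
    where
    A² Q G : ℤ
    A² = + a ℤ.* + a
    Q  = p⁺ ℤ.* Z.pow a p⁺
    G  = ((λ j → b j r) ⋆ (W ⋆ units a q)) k₀
    lem₁ : ∀ d x y → d ℤ.* (x ℤ.* y) ≡ x ℤ.* (d ℤ.* y)
    lem₁ = solve-∀
    lem₂ : ∀ x y → x ℤ.* - y ≡ - (x ℤ.* y)
    lem₂ = solve-∀
    lem₃ : ∀ a Q σ r S → a ℤ.* a ℤ.* Q ℤ.* - (- + 1 ℤ.* σ ℤ.* r ℤ.* S) ≡ σ ℤ.* r ℤ.* (a ℤ.* a) ℤ.* S ℤ.* Q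
    lem₃ = solve-∀
    index : suc k₀ ℕ.+ suc k₀ ≡ suc (a ℕ.* p)
    index = lem h r
      where
      lem : ∀ h r → suc (h ℕ.+ r ℕ.* suc (h ℕ.+ h)) ℕ.+ suc (h ℕ.+ r ℕ.* suc (h ℕ.+ h)) ≡
        suc (suc (2 ℕ.* r) ℕ.* suc (h ℕ.+ h))
      lem = ℕSolver.solve-∀
    v≡ : den ℤ.* v (suc (suc k₀)) ≡ A² ℤ.* Q ℤ.* (den ℤ.* G)
    v≡ = ≡.trans (cong (den ℤ.*_) (v-factor q r k₀ index)) (lem₁ den (A² ℤ.* Q) G)
    core : den ℤ.* G P.≈ - (sign ℤ.* + r ℤ.* Ssum r)
    core = P.trans (P.*-congˡ {den} coefficient-mod)
      (P.trans (P.reflexive (lem₂ den moment)) (P.-‿cong moment-mod))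

-- From congruences to divisibility and rational numbers

open import Data.Nat using (_≤_; _+_; _*_; _^_; _/_; _∸_)

parity : ∀ n → ∃ λ k → (n ≡ k + k) ⊎ (n ≡ suc (k + k))
parity zero    = 0 , inj₁ ≡.refl
parity (suc n) with parity n
... | k , inj₁ e = k , inj₂ (cong suc e)
... | k , inj₂ e = suc k , inj₁ (cong suc (≡.trans e (≡.sym (ℕP.+-suc k k))))

odd-prime : ∀ {p} → Prime p → 3 ≤ p → ∃ λ g → p ≡ suc (suc g + suc g)
odd-prime {p} p-prime 3≤p with parity p
... | suc g , inj₂ e = g , e
... | zero  , inj₂ ≡.refl with s≤s () ← 3≤p
... | k     , inj₁ e with Primality.prime⇒irreducible p-prime
                            (ℕD.divides k (≡.trans e (≡.trans (cong (k ℕ.+_) (≡.sym (ℕP.+-identityʳ k))) (ℕP.*-comm 2 k))))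
...   | inj₂ ≡.refl with s≤s (s≤s ()) ← 3≤p

half-shift : ∀ h → (suc (h + h) + 3) / 2 ≡ suc (suc h)
half-shift h = ≡.trans (cong (_/ 2) (lem h)) (ℕDivMod.m*n/n≡m (suc (suc h)) 2)
  where
  lem : ∀ h → suc (h + h) + 3 ≡ suc (suc h) * 2
  lem = ℕSolver.solve-∀

mod⇒∣ᵤ : ∀ {x y m} → x ≡ y [ m ] → m ∣ (x - y)
mod⇒∣ᵤ e = Signed.∣⇒∣ᵤ (mod⇒∣ e)

-- Rationals are stored in lowest terms, so the numerator and denominator of the product have no
-- closed form; what can be used is its cross-multiplied equality with nP / d, taken from the
-- unnormalised rationals.
fraction-equation : ∀ n d P .{{_ : NonZero d}} →
  ↥ (n ℚ./ d ℚ.* (+ P ℚ./ 1)) ℤ.* + d ≡ n ℤ.* + P ℤ.* ↧ (n ℚ./ d ℚ.* (+ P ℚ./ 1))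
fraction-equation n d@(suc d-1) P with ℚᵘP.≃-trans (ℚP.toℚᵘ-homo-* (n ℚ./ d) (+ P ℚ./ 1))
  (ℚᵘP.*-cong (ℚP.toℚᵘ-fromℚᵘ (ℚᵘ.mkℚᵘ n d-1)) (ℚP.toℚᵘ-fromℚᵘ (ℚᵘ.mkℚᵘ (+ P) 0)))
... | ℚᵘ.*≡* e = ≡.trans (cong₂ (λ i m → i ℤ.* + m) (≡.sym (ℚP.↥ᵘ-toℚᵘ x)) (≡.sym (ℕP.*-identityʳ d)))
  (≡.trans e (cong (n ℤ.* + P ℤ.*_) (ℚP.↧ᵘ-toℚᵘ x)))
  where
  x : ℚ
  x = n ℚ./ d ℚ.* (+ P ℚ./ 1)

reduced : ∀ y → Coprime ∣ ↥ y ∣ (↧ₙ y)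
reduced (ℚ.mkℚ _ _ c) = Coprimality.recompute c

-- Since y is reduced, `fraction-equation` forces its denominator to divide d, which gives
-- coprimality to m. Multiplying the wanted congruence by the unit d turns it into the hypothesis
-- times that denominator.
fraction-mod : ∀ x n d P m .{{_ : NonZero d}} → Coprime d m →
  + d ℤ.* x ≡ n ℤ.* + P [ + m ] → x ≡ n ℚ./ d ℚ.* (+ P ℚ./ 1) modℚ m
fraction-mod x n d P m d⊥m e = ↧⊥m , mod⇒∣ᵤ (mod-cancel (+ d) d⊥m cleared)
  where
  y : ℚ
  y = n ℚ./ d ℚ.* (+ P ℚ./ 1)
  equation : ↥ y ℤ.* + d ≡ n ℤ.* + P ℤ.* ↧ y
  equation = fraction-equation n d P
  ↧∣d : ↧ₙ y ℕD.∣ d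
  ↧∣d = Coprimality.coprime-divisor (Coprimality.sym (reduced y))
    (subst (↧ₙ y ℕD.∣_) (≡.trans (cong ∣_∣ (≡.sym equation)) (ℤP.abs-* (↥ y) (+ d)))
      (subst (↧ₙ y ℕD.∣_) (≡.sym (ℤP.abs-* (n ℤ.* + P) (↧ y))) (ℕD.n∣m*n ∣ n ℤ.* + P ∣)))
  ↧⊥m : Coprime (↧ₙ y) m
  ↧⊥m (i∣↧ , i∣m) = d⊥m (ℕD.∣-trans i∣↧ ↧∣d , i∣m)
  module M = Ring (ℤmod (+ m))
  swap : ∀ d x z → d ℤ.* (x ℤ.* z) ≡ d ℤ.* x ℤ.* z
  swap = solve-∀
  cleared : + d ℤ.* (x ℤ.* ↧ y) M.≈ + d ℤ.* ↥ y
  cleared = M.begin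
    + d ℤ.* (x ℤ.* ↧ y)   M.≡⟨ swap (+ d) x (↧ y) ⟩
    + d ℤ.* x ℤ.* ↧ y     M.≈⟨ M.*-congʳ {↧ y} e ⟩
    n ℤ.* + P ℤ.* ↧ y     M.≡⟨ ≡.trans (≡.sym equation) (ℤP.*-comm (↥ y) (+ d)) ⟩
    + d ℤ.* ↥ y M.∎

module _ (g : ℕ) (p-prime : Prime (suc (suc g + suc g))) where
  open OddPrime g p-prime

  part₁-p⁵ : Coprime 3 p → (+ (p ^ 5)) ∣ (v ((p + 3) / 2)
    - (+ (2 * p ^ 3) ℤ.* (+ 1 - + p) ℤ.* + ((p ∸ 1) !) ℤ.* + (4 ^ (p ∸ 1))))
  part₁-p⁵ 3⊥p = mod⇒∣ᵤ (subst (λ n → v n ≡ target [ + (p ^ 5) ]) (≡.sym (half-shift h))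
    (subst (λ m → v (suc (suc h)) ≡ target [ m ]) modulus
      (subst (λ y → v (suc (suc h)) ≡ y [ p⁺ ℤ.* p⁺ ℤ.* (p⁺ ℤ.* p⁺ ℤ.* p⁺) ]) value (v-mod-p⁵ 3⊥p))))
    where
    target : ℤ
    target = + (2 * p ^ 3) ℤ.* (+ 1 - + p) ℤ.* + ((p ∸ 1) !) ℤ.* + (4 ^ (p ∸ 1))
    lem₁ : ∀ p → p ℤ.* p ℤ.* (p ℤ.* p ℤ.* p) ≡ p ℤ.* (p ℤ.* (p ℤ.* (p ℤ.* (p ℤ.* + 1))))
    lem₁ = solve-∀
    lem₂ : ∀ p → + 2 ℤ.* (p ℤ.* p ℤ.* p) ≡ + 2 ℤ.* (p ℤ.* (p ℤ.* (p ℤ.* + 1)))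
    lem₂ = solve-∀
    modulus : p⁺ ℤ.* p⁺ ℤ.* (p⁺ ℤ.* p⁺ ℤ.* p⁺) ≡ + (p ^ 5)
    modulus = ≡.trans (lem₁ p⁺) (≡.sym (pos-^ p 5))
    value : + 2 ℤ.* (p⁺ ℤ.* p⁺ ℤ.* p⁺) ℤ.* (+ 1 - p⁺) ℤ.* + (q !) ℤ.* Z.pow q (+ 4) ≡ target
    value = cong₂ (λ x y → x ℤ.* (+ 1 - p⁺) ℤ.* + (q !) ℤ.* y)
      (≡.trans (lem₂ p⁺) (≡.sym (≡.trans (ℤP.pos-* 2 (p ^ 3)) (cong (+ 2 ℤ.*_) (pos-^ p 3)))))
      (≡.sym (pos-^ 4 q))

  -- A weakening of the congruence modulo p⁵: next to 2p³ the cofactor (1 - p)(p - 1)! 4^(p-1)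
  -- matters only modulo p, where Wilson and Fermat give -1.
  part₁-p⁴ : Coprime 3 p → (+ (p ^ 4)) ∣ (v ((p + 3) / 2) ℤ.+ + (2 * p ^ 3))
  part₁-p⁴ 3⊥p = subst (λ y → (+ (p ^ 4)) ∣ (v ((p + 3) / 2) ℤ.+ y)) (ℤP.neg-involutive (+ (2 * p ^ 3)))
    (mod⇒∣ᵤ (subst (λ n → v n ≡ - + (2 * p ^ 3) [ + (p ^ 4) ]) (≡.sym (half-shift h))
      (subst (λ m → v (suc (suc h)) ≡ - + (2 * p ^ 3) [ m ]) modulus
        (subst (λ y → v (suc (suc h)) ≡ y [ p⁺ ℤ.* (p⁺ ℤ.* p⁺ ℤ.* p⁺) ]) value
          (M.trans weakened leading)))))
    where
    module M = Ring (ℤmod (p⁺ ℤ.* (p⁺ ℤ.* p⁺ ℤ.* p⁺)))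
    P³ F T : ℤ
    P³ = p⁺ ℤ.* p⁺ ℤ.* p⁺
    F = + (q !)
    T = Z.pow q (+ 4)
    lem₁ : ∀ p → p ℤ.* (p ℤ.* p ℤ.* p) ≡ p ℤ.* (p ℤ.* (p ℤ.* (p ℤ.* + 1)))
    lem₁ = solve-∀
    lem₂ : ∀ p → + 2 ℤ.* (p ℤ.* p ℤ.* p) ℤ.* - + 1 ≡ - (+ 2 ℤ.* (p ℤ.* (p ℤ.* (p ℤ.* + 1))))
    lem₂ = solve-∀
    lem₃ : ∀ P p F T → + 2 ℤ.* P ℤ.* (+ 1 - p) ℤ.* F ℤ.* T ≡ + 2 ℤ.* P ℤ.* ((+ 1 - p) ℤ.* F ℤ.* T)
    lem₃ = solve-∀
    lem₄ : ∀ p → + 1 - p ≡ + 1 ℤ.+ p ℤ.* - + 1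
    lem₄ = solve-∀
    lem₅ : ∀ p P → + 2 ℤ.* P ℤ.* p ≡ + 2 ℤ.* (p ℤ.* P)
    lem₅ = solve-∀
    modulus : p⁺ ℤ.* (p⁺ ℤ.* p⁺ ℤ.* p⁺) ≡ + (p ^ 4)
    modulus = ≡.trans (lem₁ p⁺) (≡.sym (pos-^ p 4))
    value : + 2 ℤ.* P³ ℤ.* - + 1 ≡ - + (2 * p ^ 3)
    value = ≡.trans (lem₂ p⁺) (cong -_ (≡.sym (≡.trans (ℤP.pos-* 2 (p ^ 3)) (cong (+ 2 ℤ.*_) (pos-^ p 3)))))
    weakened : v (suc (suc h)) M.≈ + 2 ℤ.* P³ ℤ.* (+ 1 - p⁺) ℤ.* F ℤ.* T
    weakened = mod-weaken p⁺ (subst (λ m → v (suc (suc h)) ≡ + 2 ℤ.* P³ ℤ.* (+ 1 - p⁺) ℤ.* F ℤ.* T [ m ])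
      (ℤP.*-assoc p⁺ p⁺ P³) (v-mod-p⁵ 3⊥p))
    unit : (+ 1 - p⁺) ℤ.* F ℤ.* T P.≈ - + 1
    unit = P.*-cong {(+ 1 - p⁺) ℤ.* F} { - + 1}
      (P.*-cong {+ 1 - p⁺} {+ 1} (mod (- + 1) (lem₄ p⁺)) wilson) (fermat-square coprime-2)
    leading : + 2 ℤ.* P³ ℤ.* (+ 1 - p⁺) ℤ.* F ℤ.* T M.≈ + 2 ℤ.* P³ ℤ.* - + 1
    leading = M.trans (M.reflexive (lem₃ P³ p⁺ F T))
      (mod-weaken (+ 2) (subst (λ m → + 2 ℤ.* P³ ℤ.* ((+ 1 - p⁺) ℤ.* F ℤ.* T) ≡ + 2 ℤ.* P³ ℤ.* - + 1 [ m ])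
        (lem₅ p⁺ P³) (mod-scale (+ 2 ℤ.* P³) unit)))

  part₂ : ∀ r′ → (2r<p : 2 * suc r′ ℕ.< p) → let r = suc r′ in
    v ((p + 3) / 2 + r * p) ≡ C r ℚ.* ((+ (p ^ (2 * r + 2))) ℚ./ 1) modℚ (p ^ (2 * r + 3))
  part₂ r′ 2r<p = fraction-mod (v ((p + 3) / 2 + r * p)) num (Cden r) (p ^ (2 * r + 2)) (p ^ (2 * r + 3)) {{Cden≢0 r}}
    (coprime-^ (2 * r + 3) coprime-Cden)
    (subst (λ n → + Cden r ℤ.* v (n + r * p) ≡ num ℤ.* + (p ^ (2 * r + 2)) [ + (p ^ (2 * r + 3)) ])
      (≡.sym (half-shift h))
      (subst (λ m → + Cden r ℤ.* v (suc (suc k₀)) ≡ num ℤ.* + (p ^ (2 * r + 2)) [ m ]) modulus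
        (≡.subst₂ (λ x y → x ≡ y [ Q ℤ.* p⁺ ]) (cong (ℤ._* v (suc (suc k₀))) (≡.sym den≡))
          (cong₂ ℤ._*_ num≡ power) v-multiple)))
    where
    open Blocks g p-prime r′ 2r<p
    Q num : ℤ
    Q = p⁺ ℤ.* Z.pow a p⁺
    num = (- (+ 1)) ℤ.^ r′ ℤ.* + r ℤ.* (+ (suc (2 * r))) ℤ.^ 2 ℤ.* Ssum r
    coprime-Cden : Coprime (Cden r) p
    coprime-Cden = coprime-* (^-coprime r′ (coprime-* {2} {2} coprime-2 coprime-2))
      (coprime-* (coprime-! r r≤q) (coprime-! r r≤q))
    den≡ : + Cden r ≡ den
    den≡ = ≡.trans (ℤP.pos-* (4 ^ r′) (r ! * r !)) (cong₂ ℤ._*_ (pos-^ 4 r′) (ℤP.pos-* (r !) (r !)))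
    pow≡^ : ∀ n x → Z.pow n x ≡ x ℤ.^ n
    pow≡^ zero    x = ≡.refl
    pow≡^ (suc n) x = cong (x ℤ.*_) (pow≡^ n x)
    num≡ : numerator ≡ num
    num≡ = cong₂ (λ x y → x ℤ.* + r ℤ.* y ℤ.* Ssum r) (pow≡^ r′ (- + 1))
      (cong (+ a ℤ.*_) (≡.sym (ℤP.*-identityʳ (+ a))))
    power : Q ≡ + (p ^ (2 * r + 2))
    power = ≡.trans (≡.sym (pos-^ p (suc a))) (cong (λ n → + (p ^ n)) (ℕP.+-comm 2 (2 * r)))
    modulus : Q ℤ.* p⁺ ≡ + (p ^ (2 * r + 3))
    modulus = ≡.trans (ℤP.*-comm Q p⁺) (≡.trans (≡.sym (pos-^ p (suc (suc a))))
      (cong (λ n → + (p ^ n)) (ℕP.+-comm 3 (2 * r))))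

theorem2 :
    (∀ (p : ℕ) → Prime p → 5 ≤ p →
        ((+ (p ^ 4)) ∣ (v ((p + 3) / 2) ℤ.+ + (2 * p ^ 3)))
      × ((+ (p ^ 5)) ∣ (v ((p + 3) / 2)
            - (+ (2 * p ^ 3) ℤ.* (+ 1 - + p) ℤ.* + ((p ∸ 1) !) ℤ.* + (4 ^ (p ∸ 1))))))
    ×
    (∀ (r p : ℕ) → 1 ≤ r → Prime p → 2 * r + 1 ≤ p →
        v ((p + 3) / 2 + r * p) ≡ C r ℚ.* ((+ (p ^ (2 * r + 2))) ℚ./ 1) modℚ (p ^ (2 * r + 3)))
theorem2 = first , second
  where
  first : ∀ (p : ℕ) → Prime p → 5 ≤ p →
        ((+ (p ^ 4)) ∣ (v ((p + 3) / 2) ℤ.+ + (2 * p ^ 3)))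
      × ((+ (p ^ 5)) ∣ (v ((p + 3) / 2)
            - (+ (2 * p ^ 3) ℤ.* (+ 1 - + p) ℤ.* + ((p ∸ 1) !) ℤ.* + (4 ^ (p ∸ 1)))))
  first p p-prime 5≤p with odd-prime p-prime (ℕP.≤-trans (s≤s (s≤s (s≤s z≤n))) 5≤p)
  ... | g , ≡.refl = part₁-p⁴ g p-prime 3⊥p , part₁-p⁵ g p-prime 3⊥p
    where
    3⊥p : Coprime 3 p
    3⊥p = Coprimality.sym (Coprimality.prime⇒coprime p-prime (ℕP.≤-trans (s≤s (s≤s (s≤s (s≤s z≤n)))) 5≤p))
  second : ∀ (r p : ℕ) → 1 ≤ r → Prime p → 2 * r + 1 ≤ p →
    v ((p + 3) / 2 + r * p) ≡ C r ℚ.* ((+ (p ^ (2 * r + 2))) ℚ./ 1) modℚ (p ^ (2 * r + 3))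
  second (suc r′) p 1≤r p-prime 2r<p
    with odd-prime p-prime (ℕP.≤-trans (ℕP.+-monoˡ-≤ 1 (ℕP.*-monoʳ-≤ 2 1≤r)) 2r<p)
  ... | g , ≡.refl = part₂ g p-prime r′ (subst (ℕ._≤ p) (ℕP.+-comm (2 * suc r′) 1) 2r<p)
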